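{- Let $t,u,v\in\mathrm{ACol}(C_n)$ and $w=tuv$, and let $w^0$ be the highest weight word of the connected component of $w$ in the crystal graph on $\mathrm{ACol}(C_n)^*$. Then $\mathrm{conf}(w)=\mathrm{conf}(w^0)$.
   Context: Setting: $C_n=\{1<\cdots<n<\overline n<\cdots<\overline1\}$ with its type $C$ crystal graph; Kashiwara operators act on $C_n^*$ by the tensor product rule. Columns, admissible columns, $\preceq$, tableau words, $Pl(C_n)$ and column insertion are the standard type $C$ notions (Lecouvey). $\mathrm{ACol}(C_n)$ is the set of admissible columns together with an extra symbol $\epsilon$; $p:\mathrm{ACol}(C_n)^*\to C_n^*$ sends $\epsilon$ to the empty word and each admissible column to itself. $\preceq$ is extended by $c\preceq\epsilon$ for all $c$ and $\epsilon\not\preceq c$ for $c\ne\epsilon$; $(c_1\leftarrow c_2)\in\mathrm{ACol}(C_n)^2$ is $d_1d_2$, $\epsilon d$, or $\epsilon\epsilon$ according as the tableau word of $p(c_1)p(c_2)$ is $d_1d_2$, one column $d$, or empty. $\mathbf{ACol}$ is the (convergent) 2-polygraph with generators $\mathrm{ACol}(C_n)$ and rules $c_1c_2\Rightarrow(c_1\leftarrow c_2)$ for $c_2\not\preceq c_1$. Crystal structure on $\mathrm{ACol}(C_n)^*$: $f_iw$ (resp. $e_iw$) is defined iff $f_ip(w)$ (resp. $e_ip(w)$) is defined, and then is obtained by replacing the column of $w$ containing the modified letter by the modified column; $w$ is of highest weight if no $e_i$ is defined on it. For a word $w$ of three letters of $\mathrm{ACol}(C_n)$, let $a(w)$ be the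 longest sequence of rewriting steps starting from $w$ that alternately rewrites the pair in positions $(1,2)$, then $(2,3)$, then $(1,2)$, etc., starting with positions $(1,2)$ (the leftmost reduction strategy), and $b(w)$ the analogous longest alternating sequence starting with positions $(2,3)$ (the rightmost reduction strategy). Both are finite and end at the normal form of $w$. The confluence pair is $\mathrm{conf}(w)=(|a(w)|,|b(w)|)$, the numbers of rewriting steps. -}

module Defs where

open import Data.Bool.Base using (if_then_else_)
open import Data.Fin.Base as Fin using (Fin; zero; suc; toℕ)
import Data.Fin.Properties as Fin
open import Data.List.Base
  using (List; []; _∷_; [_]; _++_; map; concatMap; filter; head; reverse; allFin; foldr)
open import Data.List.Relation.Binary.Prefix.Heterogeneous using (Prefix)
open import Data.List.Relation.Unary.Linked using (Linked)
import Data.List.Membership.DecPropositional as DecMembership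
open import Data.Maybe.Base as Maybe using (Maybe; just; nothing; maybe′; _>>=_)
import Data.Maybe.Properties as Maybe
open import Data.Nat.Base using (ℕ; zero; suc; _+_; _∸_; _≤_)
open import Data.Nat.Properties as ℕ using (_<?_)
open import Data.Product.Base using (Σ-syntax; _×_; _,_; proj₁)
open import Data.Sum.Base using (_⊎_; inj₁; inj₂)
open import Data.Sum.Properties using () renaming (≡-dec to ⊎-≡-dec)
open import Data.Sum.Relation.Binary.LeftOrder using (_⊎-<_)
open import Function.Base using (const; flip)
open import Function.Bundles using (Inverse; _⇔_)
open import Level using (0ℓ)
open import Relation.Binary.Bundles using (Setoid)
open import Relation.Binary.Construct.Closure.Equivalence using (EqClosure)
open import Relation.Binary.Construct.Closure.ReflexiveTransitive using (ε)
import Relation.Binary.Construct.On as On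
open import Relation.Binary.Definitions using (DecidableEquality)
open import Relation.Binary.PropositionalEquality using (_≡_; cong₂; setoid)
open import Relation.Nullary.Decidable using (Dec; does; _×-dec_; ¬?)
open import Relation.Nullary.Negation using (¬_)

------------------------------------------------------------------------
-- The ordered alphabet 1 < ⋯ < n < n̄ < ⋯ < 1̄.
-- The index k : Fin n stands for the integer k + 1.

Letter : ℕ → Set
Letter n = Fin n ⊎ Fin n

pattern un  k = inj₁ k
pattern bar k = inj₂ k

infix 4 _<ˡ_ _≤ˡ_ _≟_

_<ˡ_ _≤ˡ_ : ∀ {n} → Letter n → Letter n → Set
_<ˡ_ = Fin._<_ ⊎-< flip Fin._<_
_≤ˡ_ = Fin._≤_ ⊎-< flip Fin._≤_

_≟_ : ∀ {n} → DecidableEquality (Letter n)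
_≟_ = ⊎-≡-dec Fin._≟_ Fin._≟_

module _ {n : ℕ} where
  open DecMembership (_≟_ {n}) public using (_∈_; _∈?_)

Word : ℕ → Set
Word n = List (Letter n)

------------------------------------------------------------------------
-- The type C crystal

-- next i is i + 1, undefined for i = n.
next : ∀ {n} → Fin n → Maybe (Fin n)
next {suc zero}    zero    = nothing
next {suc (suc _)} zero    = just (suc zero)
next {suc _}       (suc i) = Maybe.map suc (next i)

-- On letters: i → i+1 and the bar of i+1 → ī for i < n; n → n̄ for i = n.
fˡ eˡ : ∀ {n} → Fin n → Letter n → Maybe (Letter n)
fˡ i (un k)  = if does (k Fin.≟ i)
               then just (maybe′ un (bar i) (next i)) else nothing
fˡ i (bar k) = if does (Maybe.≡-dec Fin._≟_ (next i) (just k))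
               then just (bar i) else nothing
eˡ i (un k)  = if does (Maybe.≡-dec Fin._≟_ (next i) (just k))
               then just (un i) else nothing
eˡ i (bar k) = if does (k Fin.≟ i)
               then just (maybe′ bar (un i) (next i)) else nothing

-- Every i-string of letters has length at most 1.
φˡ εˡ : ∀ {n} → Fin n → Letter n → ℕ
φˡ i x = maybe′ (const 1) 0 (fˡ i x)
εˡ i x = maybe′ (const 1) 0 (eˡ i x)

-- Tensor product rule: f acts on the left factor of a ⊗ b iff φ a > ε b,
-- and e acts on the right factor iff φ a < ε b.
εʷ : ∀ {n} → Fin n → Word n → ℕ
εʷ i []      = 0
εʷ i (x ∷ w) = εˡ i x + (εʷ i w ∸ φˡ i x)

f e : ∀ {n} → Fin n → Word n → Maybe (Word n)
f i []      = nothing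
f i (x ∷ w) = if does (εʷ i w <? φˡ i x)
              then Maybe.map (_∷ w) (fˡ i x)
              else Maybe.map (x ∷_) (f i w)
e i []      = nothing
e i (x ∷ w) = if does (φˡ i x <? εʷ i w)
              then Maybe.map (x ∷_) (e i w)
              else Maybe.map (_∷ w) (eˡ i x)

infix 4 _–⟨_⟩→_ _~_

_–⟨_⟩→_ : ∀ {n} → Word n → Fin n → Word n → Set
w –⟨ i ⟩→ w′ = f i w ≡ just w′

ConnectedWords : ∀ {n} → Word n → Word n → Set
ConnectedWords = EqClosure (λ w w′ → Σ[ i ∈ Fin _ ] w –⟨ i ⟩→ w′)

-- The vertex set B(w) of the connected component of w.
Component : ∀ {n} → Word n → Setoid 0ℓ 0ℓ
Component {n} w =
  On.setoid {B = Σ[ x ∈ Word n ] ConnectedWords w x} (setoid (Word n)) proj₁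

-- The plactic congruence: w and w′ occur at the same place of two isomorphic
-- components.  Isomorphisms of coloured directed graphs are enough, since
-- the weight of a vertex is determined by the lengths of the strings through it.
record _~_ {n} (w w′ : Word n) : Set where
  field
    iso   : Inverse (Component w) (Component w′)
  open Inverse iso public using (to; from)
  field
    edge  : ∀ i x y →
            (proj₁ x –⟨ i ⟩→ proj₁ y) ⇔ (proj₁ (to x) –⟨ i ⟩→ proj₁ (to y))
    place : proj₁ (to (w , ε)) ≡ w′

------------------------------------------------------------------------
-- Admissible columns

descending : ∀ n → List (Fin n)
descending n = reverse (allFin n)

greatest : ∀ {n} {P : Fin n → Set} → (∀ k → Dec (P k)) → Maybe (Fin n)
greatest P? = head (filter P? (descending _))

-- The z with z and z̄ both in the column, in decreasing order.
pairs : ∀ {n} → Word n → List (Fin n)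
pairs C = filter (λ z → (un z ∈? C) ×-dec (bar z ∈? C)) (descending _)

-- Given z₁ > z₂ > ⋯, choose tᵢ greatest with tᵢ < min (tᵢ₋₁ , zᵢ) and
-- tᵢ, t̄ᵢ ∉ C; returns the (zᵢ , tᵢ).  The second argument is the bound tᵢ₋₁.
choose : ∀ {n} → Word n → ℕ → List (Fin n) → Maybe (List (Fin n × Fin n))
choose C b []       = just []
choose C b (z ∷ zs) =
  greatest (λ t → (toℕ t <? b) ×-dec (t Fin.<? z)
                  ×-dec ¬? (un t ∈? C) ×-dec ¬? (bar t ∈? C)) >>= λ t →
  Maybe.map ((z , t) ∷_) (choose C (toℕ t) zs)

-- The column can be split when this is defined.
split : ∀ {n} → Word n → Maybe (List (Fin n × Fin n))
split {n} C = choose C n (pairs C)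

-- A column is identified with its reading, from top to bottom.
record Column (n : ℕ) : Set where
  field
    first      : Letter n
    rest       : Word n
  letters : Word n
  letters = first ∷ rest
  field
    increasing : Linked _<ˡ_ letters
    splitting  : List (Fin n × Fin n)
    admissible : split letters ≡ just splitting
open Column public using (letters; splitting)

-- Rearranges distinct letters in increasing order.
arrange : ∀ {n} → Word n → Word n
arrange {n} xs =
  filter (_∈? xs) (map inj₁ (allFin n) ++ map inj₂ (descending n))

replace : ∀ {n} → Letter n → Letter n → Word n → Word n
replace x y = map (λ c → if does (c ≟ x) then y else c)

leftColumn rightColumn : ∀ {n} → Column n → Word n
leftColumn  C =
  arrange (foldr (λ (z , t) → replace (un z) (un t)) (letters C) (splitting C))
rightColumn C =
  arrange (foldr (λ (z , t) → replace (bar z) (bar t)) (letters C) (splitting C))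

infix 4 _⪯_ _⪯ᴬ_

-- C ⪯ D: rC is at least as tall as lD, and rC ≤ lD in each row of lD.
_⪯_ : ∀ {n} → Column n → Column n → Set
C ⪯ D = Prefix (flip _≤ˡ_) (leftColumn D) (rightColumn C)

-- A tableau C₁ ⪯ C₂ ⪯ ⋯ ⪯ C_r is read C_r ⋯ C₁; the list is in reading order.
record TableauWord {n} (w : Word n) (Cs : List (Column n)) : Set where
  field
    tableau : Linked (flip _⪯_) Cs
    plactic : w ~ concatMap letters Cs

------------------------------------------------------------------------
-- The column presentation

data ACol (n : ℕ) : Set where
  col : Column n → ACol n
  ϵ   : ACol n

lettersᴬ : ∀ {n} → ACol n → Word n
lettersᴬ (col C) = letters C
lettersᴬ ϵ       = []

p : ∀ {n} → List (ACol n) → Word n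
p = concatMap lettersᴬ

data _⪯ᴬ_ {n} : ACol n → ACol n → Set where
  col : ∀ {C D} → C ⪯ D → col C ⪯ᴬ col D
  _⪯ϵ : ∀ c → c ⪯ᴬ ϵ

infix 4 _←_≔_·_ _·_⇒_·_

-- c₁ ← c₂ ≔ d₁ · d₂ is the graph of (c₁ ← c₂) = d₁ d₂.
data _←_≔_·_ {n} (c₁ c₂ : ACol n) : ACol n → ACol n → Set where
  two  : ∀ {D₁ D₂} → TableauWord (p (c₁ ∷ c₂ ∷ [])) (D₁ ∷ D₂ ∷ []) →
         c₁ ← c₂ ≔ col D₁ · col D₂
  one  : ∀ {D} → TableauWord (p (c₁ ∷ c₂ ∷ [])) (D ∷ []) →
         c₁ ← c₂ ≔ ϵ · col D
  none : TableauWord (p (c₁ ∷ c₂ ∷ [])) [] →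
         c₁ ← c₂ ≔ ϵ · ϵ

_·_⇒_·_ : ∀ {n} → ACol n → ACol n → ACol n → ACol n → Set
c₁ · c₂ ⇒ d₁ · d₂ = ¬ (c₂ ⪯ᴬ c₁) × c₁ ← c₂ ≔ d₁ · d₂

------------------------------------------------------------------------
-- The crystal on words of columns

-- f i replaces by C′ the column C, the one containing the modified letter.
data Edge {n} (i : Fin n) : List (ACol n) → List (ACol n) → Set where
  edge : ∀ xs {C C′} ys →
         f i (p (xs ++ col C ∷ ys)) ≡ just (p xs ++ letters C′ ++ p ys) →
         Edge i (xs ++ col C ∷ ys) (xs ++ col C′ ∷ ys)

Connected : ∀ {n} → List (ACol n) → List (ACol n) → Set
Connected = EqClosure (λ w w′ → Σ[ i ∈ Fin _ ] Edge i w w′)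

HighestWeight : ∀ {n} → List (ACol n) → Set
HighestWeight w = ∀ i → e i (p w) ≡ nothing

------------------------------------------------------------------------
-- The confluence pair

data Position : Set where
  ⟨12⟩ ⟨23⟩ : Position

other : Position → Position
other ⟨12⟩ = ⟨23⟩
other ⟨23⟩ = ⟨12⟩

data Step {n} : Position → List (ACol n) → List (ACol n) → Set where
  step₁₂ : ∀ {a b c a′ b′} → a · b ⇒ a′ · b′ →
           Step ⟨12⟩ (a ∷ b ∷ c ∷ []) (a′ ∷ b′ ∷ c ∷ [])
  step₂₃ : ∀ {a b c b′ c′} → b · c ⇒ b′ · c′ →
           Step ⟨23⟩ (a ∷ b ∷ c ∷ []) (a ∷ b′ ∷ c′ ∷ [])

-- Alternating s w k: some sequence of k steps from w alternates positions,
-- the first step being at s.  If the pair at s is normal, only k = 0 occurs.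
data Alternating {n} : Position → List (ACol n) → ℕ → Set where
  done : ∀ {s w} → Alternating s w 0
  _then_ : ∀ {s w w′ k} → Step s w w′ → Alternating (other s) w′ k →
           Alternating s w (suc k)

record Longest {n} (s : Position) (w : List (ACol n)) (k : ℕ) : Set where
  field
    attained : Alternating s w k
    maximal  : ∀ m → Alternating s w m → m ≤ k

-- Conf w (k , l) is the graph of conf(w) = (k , l).
Conf : ∀ {n} → List (ACol n) → ℕ × ℕ → Set
Conf w (k , l) = Longest ⟨12⟩ w k × Longest ⟨23⟩ w l

Conf-unique : ∀ {n} {w : List (ACol n)} {q r} → Conf w q → Conf w r → q ≡ r
Conf-unique (a , b) (a′ , b′) = cong₂ _,_ (unique a a′) (unique b b′)
  where
  open Longest
  unique : ∀ {n s} {w : List (ACol n)} {k l} →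
           Longest s w k → Longest s w l → k ≡ l
  unique x y = ℕ.≤-antisym (maximal y _ (attained x)) (maximal x _ (attained y))

{-# OPTIONS --safe #-}
-- A column is recorded by which of k, k̄ it contains for each k.  Reading k from
-- n down to 1, a pair k, k̄ joins a queue and an absent k serves the head of the
-- queue: this is the greedy choice of the t's, the column is admissible iff the
-- queue ends empty, and lC, rC are read off position by position.  Since f i only
-- touches k = i, i + 1, its effect on a column is one of seven local moves, all of
-- which keep the state of the queue outside the two positions, hence admissibility.
--
-- C ⪯ D means that rC has at least as many letters as lD in every initial segment
-- of the alphabet.  When f i acts on the word of D C by the tensor product rule, a
-- local check shows that these inequalities hold before iff they hold after.  So ⪯,
-- and with it tableaux and reducible pairs, are invariant under f i and its inverse,
-- and since the plactic congruence commutes with the crystal structure, every edge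
-- of the crystal on three columns carries a rewriting step to a rewriting step at
-- the same positions.

module Submission where

open import Defs hiding (_∈_)
open import Data.Bool.Base using (Bool; true; false; T; if_then_else_; b≤b; f≤t)
  renaming (_≤_ to _≤ᵇ_)
open import Data.Bool.Properties using (T?)
open import Data.Empty using (⊥-elim)
open import Data.Fin.Base as Fin using (Fin; zero; suc; toℕ)
import Data.Fin.Properties as Fin
open import Data.List.Base as List
  using (List; []; _∷_; _++_; filter; head; foldr; reverse; length; allFin)
open import Data.List.Membership.Propositional using (_∈_; _∉_)
open import Data.List.Membership.Propositional.Properties
  using (∈-allFin; ∈-map⁺; ∈-map⁻; ∈-++⁺ˡ; ∈-++⁺ʳ; ∈-++⁻; ∈-filter⁺; ∈-filter⁻)
import Data.List.Properties as List
open import Data.List.Relation.Binary.Pointwise as Pointwise using (Pointwise; []; _∷_)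
open import Data.List.Relation.Binary.Prefix.Heterogeneous using (Prefix; []; _∷_)
open import Data.List.Relation.Unary.All as All using (All; []; _∷_)
import Data.List.Relation.Unary.All.Properties as All
open import Data.List.Relation.Unary.AllPairs as AllPairs using (AllPairs; []; _∷_)
import Data.List.Relation.Unary.AllPairs.Properties as AllPairs
open import Data.List.Relation.Unary.Any using (here; there)
open import Data.List.Relation.Unary.Linked using (Linked; []; [-]; _∷_)
import Data.List.Relation.Unary.Linked.Properties as Linked
open import Data.Maybe.Base as Maybe using (Maybe; just; nothing; maybe′; _>>=_)
import Data.Maybe.Properties as Maybe
open import Data.Nat.Base
  using (ℕ; zero; suc; pred; _+_; _∸_; _≤_; _<_; z≤n; s≤s; s≤s⁻¹)
open import Data.Nat.Properties as ℕ using (_<?_)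
open import Data.Product.Base using (∃-syntax; _×_; _,_; proj₁; proj₂; map₂)
open import Data.Sum.Base as Sum using (_⊎_; inj₁; inj₂)
import Data.Sum.Properties as Sum
open import Data.Sum.Relation.Binary.LeftOrder
  using (₁∼₂; ₁∼₁; ₂∼₂; ⊎-<-transitive; ⊎-<-asymmetric)
open import Data.Vec.Base using (Vec; []; _∷_; tabulate; lookup)
import Data.Vec.Properties as Vec
open import Function.Base using (_∘_; flip; id; case_of_)
open import Function.Bundles using (Inverse; _⇔_; mk⇔; Equivalence)
open import Function.Construct.Composition using (_⇔-∘_)
open import Function.Construct.Identity using (inverse)
open import Function.Construct.Symmetry using (⇔-sym)
open import Level using (0ℓ)
open import Relation.Binary.Construct.Closure.Equivalence using (symmetric)
open import Relation.Binary.Construct.Closure.ReflexiveTransitive using (ε; _◅_; _◅◅_)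
open import Relation.Binary.Construct.Closure.Symmetric using (fwd; bwd)
open import Relation.Binary.Core using (Rel)
open import Relation.Binary.Definitions using (Asymmetric)
open import Relation.Binary.PropositionalEquality
open import Relation.Nullary.Decidable
  using (Dec; does; yes; no; _×-dec_; ¬?; dec-true; dec-false; does-⇔)
open import Relation.Nullary.Negation using (¬_)
open import Relation.Unary using (Decidable)

-- Kashiwara operators on words

-- The delicate point is the only string of length two on columns, `U D` → `N B` → `D U` at i, i +
-- 1. At its start φ(D) = 2, so f may act on D although ε(C) = 1, and then rC need not be monotone
-- at i, i + 1. What saves the comparison is that the two halves of a split column move at different
-- times: the first step of the string changes only the right half, the second only the left half.
-- In general lD changes only when φ(D) = 1, and action on D then forces ε(C) = 0; rC changes only
-- when ε(C) = 0, and action on C then forces φ(D) = 0. Either way the half that stays put is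
-- monotone at the letters concerned. A plactic isomorphism fixes string lengths but says nothing
-- about where a word is cut into columns. Words of columns are therefore followed through their
-- readings together with the lengths of the columns: string lengths tell which factor an operator
-- acts on, column lengths tell where to cut the result.

next-toℕ : ∀ {n} (i : Fin n) {k} → next i ≡ just k → toℕ k ≡ suc (toℕ i)
next-toℕ {suc (suc n)} zero refl = refl
next-toℕ {suc (suc n)} (suc i) eq with next i in ni
next-toℕ {suc (suc n)} (suc i) refl | just k = cong suc (next-toℕ i ni)

next-irrefl : ∀ {n} (i : Fin n) → next i ≢ just i
next-irrefl i eq = ℕ.1+n≢n (sym (next-toℕ i eq))

module _ {n : ℕ} (i : Fin n) where

  data Fˡ : Letter n → Letter n → Set where
    rise : ∀ {k} → next i ≡ just k → Fˡ (un i) (un k)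
    turn : next i ≡ nothing → Fˡ (un i) (bar i)
    fall : ∀ {k} → next i ≡ just k → Fˡ (bar k) (bar i)

  Fˡ-complete : ∀ x {y} → fˡ i x ≡ just y → Fˡ x y
  Fˡ-complete (un k) eq with k Fin.≟ i
  Fˡ-complete (un k) eq | yes refl with next i in ni
  Fˡ-complete (un k) refl | yes refl | just _ = rise ni
  Fˡ-complete (un k) refl | yes refl | nothing = turn ni
  Fˡ-complete (bar k) eq with Maybe.≡-dec Fin._≟_ (next i) (just k)
  Fˡ-complete (bar k) refl | yes ni = fall ni

  Fˡ-sound : ∀ {x y} → Fˡ x y → fˡ i x ≡ just y
  Fˡ-sound (rise ni) with i Fin.≟ i
  ... | yes _ rewrite ni = refl
  ... | no i≢i = ⊥-elim (i≢i refl)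
  Fˡ-sound (turn ni) with i Fin.≟ i
  ... | yes _ rewrite ni = refl
  ... | no i≢i = ⊥-elim (i≢i refl)
  Fˡ-sound (fall {k} ni) with Maybe.≡-dec Fin._≟_ (next i) (just k)
  ... | yes _ = refl
  ... | no ≢ = ⊥-elim (≢ ni)

  Fˡ-injective : ∀ {x y z} → Fˡ x z → Fˡ y z → x ≡ y
  Fˡ-injective (rise p) (rise q) = refl
  Fˡ-injective (turn p) (turn q) = refl
  Fˡ-injective (turn p) (fall q) with () ← trans (sym p) q
  Fˡ-injective (fall p) (turn q) with () ← trans (sym p) q
  Fˡ-injective (fall p) (fall q) = cong bar (Maybe.just-injective (trans (sym p) q))

  φˡ≤1 : ∀ x → φˡ i x ≤ 1
  φˡ≤1 x with fˡ i x
  ... | just _ = s≤s z≤n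
  ... | nothing = z≤n

  Fˡ-φ : ∀ {x y} → Fˡ x y → φˡ i x ≡ 1
  Fˡ-φ r rewrite Fˡ-sound r = refl

  φˡ>0 : ∀ x → 0 < φˡ i x → ∃[ y ] Fˡ x y
  φˡ>0 x pos with fˡ i x in eq
  ... | just y = y , Fˡ-complete x eq

  Fˡ-φ-end : ∀ {x y} → Fˡ x y → φˡ i y ≡ 0
  Fˡ-φ-end {y = y} r with fˡ i y in eq
  ... | nothing = refl
  ... | just z = ⊥-elim (no-string r (Fˡ-complete _ eq))
    where
    no-string : ∀ {x y z} → Fˡ x y → ¬ Fˡ y z
    no-string (rise p) (rise q) = next-irrefl i p
    no-string (rise p) (turn q) = next-irrefl i p
    no-string (turn p) (fall q) = next-irrefl i q
    no-string (fall p) (fall q) = next-irrefl i q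

  Fˡ-ε-end : ∀ {x y} → Fˡ x y → εˡ i y ≡ 1
  Fˡ-ε-end (rise {k} ni) with Maybe.≡-dec Fin._≟_ (next i) (just k)
  ... | yes _ = refl
  ... | no ≢ = ⊥-elim (≢ ni)
  Fˡ-ε-end (turn ni) with i Fin.≟ i
  ... | yes _ = refl
  ... | no i≢i = ⊥-elim (i≢i refl)
  Fˡ-ε-end (fall ni) with i Fin.≟ i
  ... | yes _ = refl
  ... | no i≢i = ⊥-elim (i≢i refl)

  Fˡ-ε : ∀ {x y} → Fˡ x y → εˡ i x ≡ 0
  Fˡ-ε (rise ni) with Maybe.≡-dec Fin._≟_ (next i) (just i)
  ... | yes eq = ⊥-elim (next-irrefl i eq)
  ... | no _ = refl
  Fˡ-ε (turn ni) with Maybe.≡-dec Fin._≟_ (next i) (just i)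
  ... | yes eq = ⊥-elim (next-irrefl i eq)
  ... | no _ = refl
  Fˡ-ε (fall {k} ni) with k Fin.≟ i
  ... | yes refl = ⊥-elim (next-irrefl i ni)
  ... | no _ = refl

  εˡ>0 : ∀ x → 0 < εˡ i x → ∃[ y ] Fˡ y x
  εˡ>0 (un k) pos with Maybe.≡-dec Fin._≟_ (next i) (just k)
  ... | yes ni = un i , rise ni
  εˡ>0 (bar k) pos with k Fin.≟ i
  ... | yes refl with next i in ni
  ...   | just j = bar j , fall ni
  ...   | nothing = un i , turn ni

  -- The formula φ(a ⊗ b) = φ(b) + max(0, φ(a) - ε(b)), companion of `εʷ`. Together they decide on
  -- which side of an arbitrary cut of a word the operator acts.
  φʷ : Word n → ℕ
  φʷ []      = 0
  φʷ (x ∷ w) = φʷ w + (φˡ i x ∸ εʷ i w)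

  -- In `here` the rule asks for ε(w) < φ(x); as φ(x) ≤ 1 for a letter, this is ε(w) = 0.
  data F : Word n → Word n → Set where
    here  : ∀ {x y w} → Fˡ x y → εʷ i w ≡ 0 → F (x ∷ w) (y ∷ w)
    there : ∀ {x w w′} → φˡ i x ≤ εʷ i w → F w w′ → F (x ∷ w) (x ∷ w′)

  F-complete : ∀ w {w′} → f i w ≡ just w′ → F w w′
  F-complete (x ∷ w) eq with fˡ i x in fx | εʷ i w in z
  F-complete (x ∷ w) refl | just y | zero = here (Fˡ-complete x fx) z
  F-complete (x ∷ w) eq | just y | suc m with f i w in fw
  F-complete (x ∷ w) refl | just y | suc m | just w″ =
    there (subst (φˡ i x ≤_) (sym z) (ℕ.≤-trans (φˡ≤1 x) (s≤s z≤n))) (F-complete w fw)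
  F-complete (x ∷ w) eq | nothing | zero with f i w in fw
  F-complete (x ∷ w) refl | nothing | zero | just w″ =
    there (subst (_≤ εʷ i w) (sym (cong (maybe′ _ 0) fx)) z≤n) (F-complete w fw)
  F-complete (x ∷ w) eq | nothing | suc m with f i w in fw
  F-complete (x ∷ w) refl | nothing | suc m | just w″ =
    there (subst (_≤ εʷ i w) (sym (cong (maybe′ _ 0) fx)) z≤n) (F-complete w fw)

  F-sound : ∀ {w w′} → F w w′ → f i w ≡ just w′
  F-sound (here r z) rewrite Fˡ-sound r | z = refl
  F-sound (there {x} {w} le r) rewrite F-sound r
    | dec-false (εʷ i w <? φˡ i x) (ℕ.≤⇒≯ le) = refl

  F-deterministic : ∀ {w x y} → F w x → F w y → x ≡ y
  F-deterministic r s = Maybe.just-injective (trans (sym (F-sound r)) (F-sound s))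

  F-ε : ∀ {w w′} → F w w′ → εʷ i w′ ≡ suc (εʷ i w)
  F-ε (here {x} {y} r z)
    rewrite z | Fˡ-ε r | Fˡ-ε-end r | ℕ.0∸n≡0 (φˡ i x) | ℕ.0∸n≡0 (φˡ i y) = refl
  F-ε (there {x} {w} le r) rewrite F-ε r =
    trans (cong (εˡ i x +_) (ℕ.+-∸-assoc 1 le)) (ℕ.+-suc (εˡ i x) _)

  F-φ : ∀ {w w′} → F w w′ → φʷ w ≡ suc (φʷ w′)
  F-φ (here {w = w} r z) rewrite z | Fˡ-φ r | Fˡ-φ-end r =
    trans (ℕ.+-suc (φʷ w) 0) refl
  F-φ (there {x} {w} {w′} le r)
    rewrite F-ε r | ℕ.m≤n⇒m∸n≡0 le | ℕ.m≤n⇒m∸n≡0 (ℕ.m≤n⇒m≤1+n le) | F-φ r = refl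

  +-∸-vanish : ∀ a {b c} → b ≤ c → a + (b ∸ c) ≡ a
  +-∸-vanish a b≤c = trans (cong (a +_) (ℕ.m≤n⇒m∸n≡0 b≤c)) (ℕ.+-identityʳ a)

  φʷ>0 : ∀ w → 0 < φʷ w → ∃[ w′ ] F w w′
  φʷ>0 (x ∷ w) pos with εʷ i w <? φˡ i x
  ... | yes lt = let y , r = φˡ>0 x (ℕ.≤-trans (s≤s z≤n) lt) in
                 y ∷ w , here r (ℕ.n<1⇒n≡0 (ℕ.≤-trans lt (φˡ≤1 x)))
  ... | no ≮ = let w′ , r = φʷ>0 w (subst (0 <_) (+-∸-vanish (φʷ w) (ℕ.≮⇒≥ ≮)) pos)
               in x ∷ w′ , there (ℕ.≮⇒≥ ≮) r

  -- Raising operators appear only as `F` read backwards, so a positive ε has to supply a preimage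
  -- under `F`.
  εʷ>0 : ∀ w → 0 < εʷ i w → ∃[ w′ ] F w′ w
  εʷ>0 (x ∷ w) pos with φˡ i x <? εʷ i w
  ... | yes lt = let w′ , r = εʷ>0 w (ℕ.≤-trans (s≤s z≤n) lt) in
                 x ∷ w′ , there (s≤s⁻¹ (subst (φˡ i x <_) (F-ε r) lt)) r
  ... | no ≮ = let y , r = εˡ>0 x (subst (0 <_) (+-∸-vanish (εˡ i x) (ℕ.≮⇒≥ ≮)) pos)
               in y ∷ w , here r (ℕ.n≤0⇒n≡0 (subst (εʷ i w ≤_) (Fˡ-φ-end r) (ℕ.≮⇒≥ ≮)))

  F-injective : ∀ {x y w} → F x w → F y w → x ≡ y
  F-injective (here r _) (here s _) = cong (_∷ _) (Fˡ-injective r s)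
  F-injective (here _ z) (there _ s) with () ← trans (sym z) (F-ε s)
  F-injective (there _ r) (here _ z) with () ← trans (sym z) (F-ε r)
  F-injective (there _ r) (there _ s) = cong (_ ∷_) (F-injective r s)

  F-length : ∀ {w w′} → F w w′ → length w ≡ length w′
  F-length (here _ _) = refl
  F-length (there _ r) = cong suc (F-length r)

  -- Associativity of the product of string lengths (the bicyclic monoid).
  ∸-assoc-+ : ∀ a b c d → a + (b ∸ c) ∸ d ≡ (a ∸ d) + (b ∸ (c + (d ∸ a)))
  ∸-assoc-+ a b c zero rewrite ℕ.0∸n≡0 a | ℕ.+-identityʳ c = refl
  ∸-assoc-+ zero b c (suc d) = ℕ.∸-+-assoc b c (suc d)
  ∸-assoc-+ (suc a) b c (suc d) = ∸-assoc-+ a b c d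

  εʷ-++ : ∀ u v → εʷ i (u ++ v) ≡ εʷ i u + (εʷ i v ∸ φʷ u)
  εʷ-++ [] v = refl
  εʷ-++ (x ∷ u) v rewrite εʷ-++ u v
    | ∸-assoc-+ (εʷ i u) (εʷ i v) (φʷ u) (φˡ i x) =
    sym (ℕ.+-assoc (εˡ i x) _ _)

  private
    -- With a = ε(u), b = ε(v), c = φ(u), d = φ(x): from φ(xu) ≤ ε(v) follows φ(x) ≤ ε(uv), so the
    -- operator passes over x. `shift⁻` goes back, given φ(u) ≤ ε(v).
    shift : ∀ a b c d → c + (d ∸ a) ≤ b → d ≤ a + (b ∸ c)
    shift a b c d le = ℕ.≤-trans (ℕ.m≤n+m∸n d a) (ℕ.+-monoʳ-≤ a
      (ℕ.≤-trans (ℕ.≤-reflexive (sym (ℕ.m+n∸m≡n c (d ∸ a)))) (ℕ.∸-monoˡ-≤ c le)))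

    shift⁻ : ∀ a b c d → c ≤ b → d ≤ a + (b ∸ c) → c + (d ∸ a) ≤ b
    shift⁻ a b c d c≤b le = ℕ.≤-trans
      (ℕ.+-monoʳ-≤ c (ℕ.≤-trans (ℕ.∸-monoˡ-≤ a le) (ℕ.≤-reflexive (ℕ.m+n∸m≡n a (b ∸ c)))))
      (ℕ.≤-reflexive (ℕ.m+[n∸m]≡n c≤b))

  F-++ˡ : ∀ {u u′ v} → F u u′ → εʷ i v < φʷ u → F (u ++ v) (u′ ++ v)
  F-++ˡ {v = v} (here {w = u} r z) lt = here r zero′
    where
    zero′ : εʷ i (u ++ v) ≡ 0
    zero′ rewrite εʷ-++ u v | z | Fˡ-φ r | ℕ.+-comm (φʷ u) 1 = ℕ.m≤n⇒m∸n≡0 (s≤s⁻¹ lt)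
  F-++ˡ {v = v} (there {x} {u} le r) lt
    rewrite ℕ.m≤n⇒m∸n≡0 le | ℕ.+-identityʳ (φʷ u) =
    there (ℕ.≤-trans le (ℕ.≤-trans (ℕ.m≤m+n _ _) (ℕ.≤-reflexive (sym (εʷ-++ u v))))) (F-++ˡ r lt)

  F-++ʳ : ∀ u {v v′} → φʷ u ≤ εʷ i v → F v v′ → F (u ++ v) (u ++ v′)
  F-++ʳ [] le r = r
  F-++ʳ (x ∷ u) {v} le r = there
    (subst (φˡ i x ≤_) (sym (εʷ-++ u v)) (shift (εʷ i u) _ _ _ le))
    (F-++ʳ u (ℕ.≤-trans (ℕ.m≤m+n _ _) le) r)

  -- The tensor product rule for any cut of a word, whereas `f` is defined by cutting off one letter
  -- at a time.
  data Tensor (u v u′ v′ : Word n) : Set where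
    left  : F u u′ → v ≡ v′ → εʷ i v < φʷ u → Tensor u v u′ v′
    right : u ≡ u′ → F v v′ → φʷ u ≤ εʷ i v → Tensor u v u′ v′

  F-tensor : ∀ u v {w} → F (u ++ v) w →
             ∃[ u′ ] ∃[ v′ ] w ≡ u′ ++ v′ × Tensor u v u′ v′
  F-tensor [] v r = [] , _ , refl , right refl r z≤n
  F-tensor (x ∷ u) v (here {y = y} r z) = y ∷ u , v , refl , left (here r εu≡0) refl lt
    where
    sum≡0 : εʷ i u + (εʷ i v ∸ φʷ u) ≡ 0
    sum≡0 = trans (sym (εʷ-++ u v)) z
    εu≡0 = ℕ.m+n≡0⇒m≡0 (εʷ i u) sum≡0
    diff≡0 : εʷ i v ∸ φʷ u ≡ 0
    diff≡0 = ℕ.m+n≡0⇒n≡0 (εʷ i u) sum≡0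
    lt : εʷ i v < φʷ (x ∷ u)
    lt rewrite εu≡0 | Fˡ-φ r | ℕ.+-comm (φʷ u) 1 = s≤s (ℕ.m∸n≡0⇒m≤n diff≡0)
  F-tensor (x ∷ u) v (there le r) with F-tensor u v r
  ... | u′ , v′ , refl , left s refl lt =
    x ∷ u′ , v′ , refl , left (there le′ s) refl (ℕ.≤-trans lt (ℕ.m≤m+n _ _))
    where
    le′ : φˡ i x ≤ εʷ i u
    le′ = subst (φˡ i x ≤_) (trans (εʷ-++ u v)
      (trans (cong (εʷ i u +_) (ℕ.m≤n⇒m∸n≡0 (ℕ.<⇒≤ lt))) (ℕ.+-identityʳ _))) le
  ... | u′ , v′ , refl , right refl s le″ =
    x ∷ u′ , v′ , refl ,
    right refl s (shift⁻ (εʷ i u) _ _ _ le″ (subst (φˡ i x ≤_) (εʷ-++ u v) le))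

  ++-split : ∀ (u u′ : Word n) {v v′} → length u ≡ length u′ →
             u ++ v ≡ u′ ++ v′ → u ≡ u′ × v ≡ v′
  ++-split [] [] _ eq = refl , eq
  ++-split (x ∷ u) (y ∷ u′) len eq with List.∷-injective eq
  ... | refl , eq′ with ++-split u u′ (ℕ.suc-injective len) eq′
  ...   | refl , v≡v′ = refl , v≡v′

  Tensor-length : ∀ {u v u′ v′} → Tensor u v u′ v′ → length u ≡ length u′
  Tensor-length (left r _ _) = F-length r
  Tensor-length (right refl _ _) = refl

  F-Tensor : ∀ {u v u′ v′} → length u ≡ length u′ → F (u ++ v) (u′ ++ v′) → Tensor u v u′ v′
  F-Tensor {u} {v} {u′} len r with F-tensor u v r
  ... | u″ , v″ , eq , t with ++-split u″ u′ (trans (sym (Tensor-length t)) len) (sym eq)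
  ...   | refl , refl = t

-- The plactic congruence

module _ {n : ℕ} where

  -- A change of base point leaves the component as it is and only lengthens the paths witnessing
  -- membership. Equality in `Component` ignores these paths, so the old isomorphism serves again.
  ~-rebase : ∀ {w z w′ z′ : Word n} (w~z : w ~ z) (c : ConnectedWords w w′) →
             proj₁ (_~_.to w~z (w′ , c)) ≡ z′ → w′ ~ z′
  ~-rebase {w} {z} {w′} {z′} w~z c at = record
    { iso = record
      { to        = λ (x , d) → map₂ (symmetric _ z→z′ ◅◅_) (to (x , c ◅◅ d))
      ; from      = λ (y , d) → map₂ (symmetric _ c ◅◅_) (from (y , z→z′ ◅◅ d))
      ; to-cong   = λ eq → to-cong eq
      ; from-cong = λ eq → from-cong eq
      ; inverse   =
          (λ {x} {y} eq → inverseˡ {_ , z→z′ ◅◅ proj₂ x} {_ , c ◅◅ proj₂ y} eq)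
        , (λ {x} {y} eq → inverseʳ {_ , c ◅◅ proj₂ x} {_ , z→z′ ◅◅ proj₂ y} eq)
      }
    ; edge  = λ i x y → arrow i _ _
    ; place = trans (to-cong refl) at
    }
    where
    open _~_ w~z renaming (edge to arrow)
    open Inverse iso using (to-cong; from-cong; inverseˡ; inverseʳ)
    z→z′ : ConnectedWords z z′
    z→z′ = subst (ConnectedWords z) at (proj₂ (to (w′ , c)))

  ~-sym : ∀ {w z : Word n} → w ~ z → z ~ w
  ~-sym {w} {z} w~z = record
    { iso = record
      { to = from ; from = to ; to-cong = from-cong ; from-cong = to-cong
      ; inverse = inverseʳ , inverseˡ }
    ; edge = λ i x y → mk⇔
        (λ r → Equivalence.from (arrow i (from x) (from y))
          (subst₂ (_–⟨ i ⟩→_) (sym (inverseˡ {x} refl)) (sym (inverseˡ {y} refl)) r))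
        (λ r → subst₂ (_–⟨ i ⟩→_) (inverseˡ {x} refl) (inverseˡ {y} refl)
          (Equivalence.to (arrow i (from x) (from y)) r))
    ; place = inverseʳ (sym place)
    }
    where
    open _~_ w~z renaming (edge to arrow)
    open Inverse iso using (to-cong; from-cong; inverseˡ; inverseʳ)

  ~-F : ∀ {i} {w z w′ : Word n} → w ~ z → F i w w′ → ∃[ z′ ] F i z z′ × w′ ~ z′
  ~-F {i} {w} w~z r = proj₁ (to (_ , c)) ,
    F-complete i _ (subst (_–⟨ i ⟩→ proj₁ (to (_ , c))) place
      (Equivalence.to (arrow i (w , ε) (_ , c)) (F-sound i r))) ,
    ~-rebase w~z c refl
    where
    open _~_ w~z renaming (edge to arrow)
    c = fwd (i , F-sound i r) ◅ ε

  ~-F⁻ : ∀ {i} {w z w′ : Word n} → w ~ z → F i w′ w → ∃[ z′ ] F i z′ z × w′ ~ z′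
  ~-F⁻ {i} {w} w~z r = proj₁ (to (_ , c)) ,
    F-complete i _ (subst (proj₁ (to (_ , c)) –⟨ i ⟩→_) place
      (Equivalence.to (arrow i (_ , c) (w , ε)) (F-sound i r))) ,
    ~-rebase w~z c refl
    where
    open _~_ w~z renaming (edge to arrow)
    c = bwd (i , F-sound i r) ◅ ε

  -- φ is the length of the outgoing i-string, and every edge of that string can be copied at the
  -- congruent word. The number `m` only bounds the induction.
  ~-φ≤ : ∀ {i} m {w z : Word n} → w ~ z → φʷ i w ≤ m → φʷ i w ≤ φʷ i z
  ~-φ≤ {i} m {w} w~z le with φʷ i w in eq
  ... | zero = z≤n
  ~-φ≤ {i} (suc m) {w} w~z (s≤s le) | suc k
    with φʷ>0 i w (subst (0 <_) (sym eq) (s≤s z≤n))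
  ... | w′ , r with ~-F w~z r
  ...   | z′ , s , w′~z′ = subst₂ _≤_ eq (sym (F-φ i s)) (subst (_≤ _) (sym (F-φ i r)) (s≤s
    (~-φ≤ m w′~z′ (subst (_≤ m) (ℕ.suc-injective (trans (sym eq) (F-φ i r))) le))))

  ~-ε≤ : ∀ {i} m {w z : Word n} → w ~ z → εʷ i w ≤ m → εʷ i w ≤ εʷ i z
  ~-ε≤ {i} m {w} w~z le with εʷ i w in eq
  ... | zero = z≤n
  ~-ε≤ {i} (suc m) {w} w~z (s≤s le) | suc k
    with εʷ>0 i w (subst (0 <_) (sym eq) (s≤s z≤n))
  ... | w′ , r with ~-F⁻ w~z r
  ...   | z′ , s , w′~z′ = subst₂ _≤_ eq (sym (F-ε i s)) (subst (_≤ _) (sym (F-ε i r)) (s≤s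
    (~-ε≤ m w′~z′ (subst (_≤ m) (ℕ.suc-injective (trans (sym eq) (F-ε i r))) le))))

  ~-φ : ∀ {i} {w z : Word n} → w ~ z → φʷ i w ≡ φʷ i z
  ~-φ w~z = ℕ.≤-antisym (~-φ≤ _ w~z ℕ.≤-refl) (~-φ≤ _ (~-sym w~z) ℕ.≤-refl)

  ~-ε : ∀ {i} {w z : Word n} → w ~ z → εʷ i w ≡ εʷ i z
  ~-ε w~z = ℕ.≤-antisym (~-ε≤ _ w~z ℕ.≤-refl) (~-ε≤ _ (~-sym w~z) ℕ.≤-refl)

-- Columns as configurations of kinds

-- Whether k, and whether k̄, belongs to a column.
Kind : Set
Kind = Bool × Bool

pattern N = false , false
pattern U = true , false
pattern D = false , true
pattern B = true , true

Config : ℕ → Set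
Config = Vec Kind

↑ : ∀ {n} → Letter n → Letter (suc n)
↑ = Sum.map suc suc

slot : ∀ {A : Set} → Bool → A → List A
slot b x = if b then x ∷ [] else []

-- Built from the outside inwards: the first index gives the least letter and, barred, the greatest,
-- with all others between them.
word : ∀ {n} → Config n → Word n
word []            = []
word ((u , b) ∷ v) = slot u (un zero) ++ List.map ↑ (word v) ++ slot b (bar zero)

-- The number of pairs z, z̄ still waiting for a t, when z is read from n down.
wait : Kind → ℕ → ℕ
wait B h = suc h
wait N h = pred h
wait U h = h
wait D h = h

excess : ∀ {n} → Config n → ℕ
excess []      = 0
excess (k ∷ v) = wait k (excess v)

positive : ℕ → Bool
positive zero    = false
positive (suc _) = true

-- `h` is the length of the queue on arrival at k. A pair `B` gives up one of its letters, and an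
-- `N` that meets a nonempty queue is one of the t's.
leftUn rightBar : Kind → ℕ → Bool
leftUn  (u , true)      h = false
leftUn  (true , false)  h = true
leftUn  (false , false) h = positive h
rightBar (true , b)      h = false
rightBar (false , true)  h = true
rightBar (false , false) h = positive h

leftConfig rightConfig : ∀ {n} → Config n → Config n
leftConfig  []      = []
leftConfig  (k ∷ v) = (leftUn k (excess v) , proj₂ k) ∷ leftConfig v
rightConfig []      = []
rightConfig (k ∷ v) = (proj₁ k , rightBar k (excess v)) ∷ rightConfig v

-- The action of f i on a column; k₁ and k₂ concern i and i + 1.
data Row : (k₁ k₂ k₁′ k₂′ : Kind) → Set where
  UN : Row U N N U
  ND : Row N D D N
  UD : Row U D N B
  NB : Row N B D U
  UB : Row U B B U
  BD : Row B D D B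

data Move : ∀ {n} → Fin n → Config n → Config n → Set where
  last  : Move zero (U ∷ []) (D ∷ [])
  pair  : ∀ {n k₁ k₂ k₁′ k₂′} {v : Config n} → Row k₁ k₂ k₁′ k₂′ →
          Move zero (k₁ ∷ k₂ ∷ v) (k₁′ ∷ k₂′ ∷ v)
  there : ∀ {n i k} {v v′ : Config n} → Move i v v′ → Move (suc i) (k ∷ v) (k ∷ v′)

-- Index i + 1 is read before i, so a pair at i + 1 is served at once by an absent i, and `U D`,
-- `N B`, `D U` all leave the queue length alone. `B` at i with `N` at i + 1, where suc (pred h) may
-- differ from h, occurs in no row.
Move-excess : ∀ {n i} {v v′ : Config n} → Move i v v′ → excess v ≡ excess v′
Move-excess last = refl
Move-excess (pair UN) = refl
Move-excess (pair ND) = refl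
Move-excess (pair UD) = refl
Move-excess (pair NB) = refl
Move-excess (pair UB) = refl
Move-excess (pair BD) = refl
Move-excess (there {k = k} m) = cong (wait k) (Move-excess m)

-- Kashiwara operators on the word of a configuration

Inactive : ∀ {n} → Fin n → Letter n → Set
Inactive i x = φˡ i x ≡ 0 × εˡ i x ≡ 0

module _ {n} (i : Fin n) where

  εʷ-inactive : ∀ {t} s → All (Inactive i) t → εʷ i (t ++ s) ≡ εʷ i s
  εʷ-inactive s [] = refl
  εʷ-inactive s ((p , q) ∷ a) rewrite p | q = εʷ-inactive s a

  φʷ-inactive : ∀ {t} s → All (Inactive i) t → φʷ i (t ++ s) ≡ φʷ i s
  φʷ-inactive s [] = refl
  φʷ-inactive {x ∷ t} s ((p , q) ∷ a) rewrite p | ℕ.0∸n≡0 (εʷ i (t ++ s)) =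
    trans (ℕ.+-identityʳ _) (φʷ-inactive s a)

  εʷ-drop : ∀ r {t} s → All (Inactive i) t → εʷ i (r ++ t ++ s) ≡ εʷ i (r ++ s)
  εʷ-drop [] s a = εʷ-inactive s a
  εʷ-drop (x ∷ r) s a = cong (λ m → εˡ i x + (m ∸ φˡ i x)) (εʷ-drop r s a)

  φʷ-drop : ∀ r {t} s → All (Inactive i) t → φʷ i (r ++ t ++ s) ≡ φʷ i (r ++ s)
  φʷ-drop [] s a = φʷ-inactive s a
  φʷ-drop (x ∷ r) s a =
    cong₂ (λ l m → l + (φˡ i x ∸ m)) (φʷ-drop r s a) (εʷ-drop r s a)

  F-inactive : ∀ {t s s′} → All (Inactive i) t → F i s s′ → F i (t ++ s) (t ++ s′)
  F-inactive [] r = r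
  F-inactive ((p , q) ∷ a) r = there (subst (_≤ _) (sym p) z≤n) (F-inactive a r)

  -- The tensor rule compares φ of the left part with ε of the right part, and inactive letters
  -- contribute to neither.
  F-insert : ∀ {r s r′ s′ t} → All (Inactive i) t → length r ≡ length r′ →
             F i (r ++ s) (r′ ++ s′) → F i (r ++ t ++ s) (r′ ++ t ++ s′)
  F-insert {r} {s} {r′} {s′} a len m with F-Tensor i {r} {s} {r′} {s′} len m
  ... | left x refl lt = F-++ˡ i x (subst (_< _) (sym (εʷ-inactive s a)) lt)
  ... | right refl x le =
    F-++ʳ i r (subst (_ ≤_) (sym (εʷ-inactive s a)) le) (F-inactive a x)

next-suc : ∀ {n} (i : Fin n) → next (suc i) ≡ Maybe.map suc (next i)
next-suc zero    = refl
next-suc (suc _) = refl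

module _ {n} (i : Fin n) where

  fˡ-↑ : ∀ x → fˡ (suc i) (↑ x) ≡ Maybe.map ↑ (fˡ i x)
  fˡ-↑ (un k) rewrite next-suc i with k Fin.≟ i
  ... | no _ = refl
  ... | yes _ with next i
  ...   | just _ = refl
  ...   | nothing = refl
  fˡ-↑ (bar k) rewrite next-suc i with next i
  ... | nothing = refl
  ... | just j with j Fin.≟ k
  ...   | yes _ = refl
  ...   | no _ = refl

  eˡ-↑ : ∀ x → eˡ (suc i) (↑ x) ≡ Maybe.map ↑ (eˡ i x)
  eˡ-↑ (bar k) rewrite next-suc i with k Fin.≟ i
  ... | no _ = refl
  ... | yes _ with next i
  ...   | just _ = refl
  ...   | nothing = refl
  eˡ-↑ (un k) rewrite next-suc i with next i
  ... | nothing = refl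
  ... | just j with j Fin.≟ k
  ...   | yes _ = refl
  ...   | no _ = refl

  φˡ-↑ : ∀ x → φˡ (suc i) (↑ x) ≡ φˡ i x
  φˡ-↑ x rewrite fˡ-↑ x with fˡ i x
  ... | just _ = refl
  ... | nothing = refl

  εˡ-↑ : ∀ x → εˡ (suc i) (↑ x) ≡ εˡ i x
  εˡ-↑ x rewrite eˡ-↑ x with eˡ i x
  ... | just _ = refl
  ... | nothing = refl

  εʷ-↑ : ∀ w → εʷ (suc i) (List.map ↑ w) ≡ εʷ i w
  εʷ-↑ [] = refl
  εʷ-↑ (x ∷ w) = cong₂ _+_ (εˡ-↑ x) (cong₂ _∸_ (εʷ-↑ w) (φˡ-↑ x))

  φʷ-↑ : ∀ w → φʷ (suc i) (List.map ↑ w) ≡ φʷ i w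
  φʷ-↑ [] = refl
  φʷ-↑ (x ∷ w) = cong₂ _+_ (φʷ-↑ w) (cong₂ _∸_ (φˡ-↑ x) (εʷ-↑ w))

  F-↑ : ∀ {w w′} → F i w w′ → F (suc i) (List.map ↑ w) (List.map ↑ w′)
  F-↑ (here {x} {w = w} r z) =
    here (Fˡ-complete (suc i) (↑ x) (trans (fˡ-↑ x) (cong (Maybe.map ↑) (Fˡ-sound i r))))
         (trans (εʷ-↑ w) z)
  F-↑ (there {x} {w} le r) = there (subst₂ _≤_ (sym (φˡ-↑ x)) (sym (εʷ-↑ w)) le) (F-↑ r)

  inactive-un : ∀ u → All (Inactive (suc i)) (slot u (un zero))
  inactive-un false = []
  inactive-un true  = (refl , eq) ∷ []
    where
    eq : εˡ (suc i) (un zero) ≡ 0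
    eq rewrite next-suc i with next i
    ... | just _ = refl
    ... | nothing = refl

  inactive-bar : ∀ b → All (Inactive (suc i)) (slot b (bar zero))
  inactive-bar false = []
  inactive-bar true  = (eq , refl) ∷ []
    where
    eq : φˡ (suc i) (bar zero) ≡ 0
    eq rewrite next-suc i with next i
    ... | just _ = refl
    ... | nothing = refl

  εʷ-there : ∀ k v → εʷ (suc i) (word (k ∷ v)) ≡ εʷ i (word v)
  εʷ-there (u , b) v =
    trans (εʷ-inactive (suc i) _ (inactive-un u)) (trans
      (cong (εʷ (suc i)) (cong (List.map ↑ (word v) ++_) (sym (List.++-identityʳ _))))
    (trans (εʷ-drop (suc i) (List.map ↑ (word v)) [] (inactive-bar b)) (trans
      (cong (εʷ (suc i)) (List.++-identityʳ (List.map ↑ (word v)))) (εʷ-↑ (word v)))))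

  φʷ-there : ∀ k v → φʷ (suc i) (word (k ∷ v)) ≡ φʷ i (word v)
  φʷ-there (u , b) v =
    trans (φʷ-inactive (suc i) _ (inactive-un u)) (trans
      (cong (φʷ (suc i)) (cong (List.map ↑ (word v) ++_) (sym (List.++-identityʳ _))))
    (trans (φʷ-drop (suc i) (List.map ↑ (word v)) [] (inactive-bar b)) (trans
      (cong (φʷ (suc i)) (List.++-identityʳ (List.map ↑ (word v)))) (φʷ-↑ (word v)))))

  F-there : ∀ k {v v′} → F i (word v) (word v′) → F (suc i) (word (k ∷ v)) (word (k ∷ v′))
  F-there (u , b) {v} {v′} r = F-inactive (suc i) (inactive-un u)
    (F-++ˡ (suc i) (F-↑ r) (subst₂ _<_ (sym zero′) (sym (trans (φʷ-↑ (word v)) (F-φ i r))) (s≤s z≤n)))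
    where
    zero′ : εʷ (suc i) (slot b (bar zero)) ≡ 0
    zero′ = trans (cong (εʷ (suc i)) (sym (List.++-identityʳ (slot b (bar zero)))))
                  (εʷ-inactive (suc i) [] (inactive-bar b))

module _ {n : ℕ} where

  heads tails : Kind → Kind → Word (suc (suc n))
  heads (u₁ , _) (u₂ , _) = slot u₁ (un zero) ++ slot u₂ (un (suc zero))
  tails (_ , b₁) (_ , b₂) = slot b₂ (bar (suc zero)) ++ slot b₁ (bar zero)

  -- The letters of a column on which f and e act for the index zero.
  core : Kind → Kind → Word (suc (suc n))
  core k₁ k₂ = heads k₁ k₂ ++ tails k₁ k₂

  map-slot : ∀ b (x : Letter (suc n)) → List.map ↑ (slot b x) ≡ slot b (↑ x)
  map-slot false x = refl
  map-slot true x = refl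

  word-core : ∀ k₁ k₂ (v : Config n) →
    word (k₁ ∷ k₂ ∷ v) ≡ heads k₁ k₂ ++ List.map ↑ (List.map ↑ (word v)) ++ tails k₁ k₂
  word-core (u₁ , b₁) (u₂ , b₂) v = begin
    s₁ ++ List.map ↑ (slot u₂ (un zero) ++ w ++ slot b₂ (bar zero)) ++ t₁
      ≡⟨ cong (λ z → s₁ ++ z ++ t₁) (List.map-++ ↑ (slot u₂ (un zero)) _) ⟩
    s₁ ++ (List.map ↑ (slot u₂ (un zero)) ++ List.map ↑ (w ++ slot b₂ (bar zero))) ++ t₁
      ≡⟨ cong (λ z → s₁ ++ z ++ t₁) (cong₂ _++_ (map-slot u₂ _)
           (trans (List.map-++ ↑ w _) (cong (List.map ↑ w ++_) (map-slot b₂ _)))) ⟩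
    s₁ ++ (s₂ ++ List.map ↑ w ++ t₂) ++ t₁
      ≡⟨ cong (s₁ ++_) (List.++-assoc s₂ _ t₁) ⟩
    s₁ ++ s₂ ++ (List.map ↑ w ++ t₂) ++ t₁
      ≡⟨ cong (λ z → s₁ ++ s₂ ++ z) (List.++-assoc (List.map ↑ w) t₂ t₁) ⟩
    s₁ ++ s₂ ++ List.map ↑ w ++ t₂ ++ t₁
      ≡⟨ List.++-assoc s₁ s₂ _ ⟨
    (s₁ ++ s₂) ++ List.map ↑ w ++ t₂ ++ t₁ ∎
    where
    open ≡-Reasoning
    s₁ = slot u₁ (un zero)
    s₂ = slot u₂ (un (suc zero))
    t₁ = slot b₁ (bar zero)
    t₂ = slot b₂ (bar (suc zero))
    w = List.map ↑ (word v)

  inactive-↑↑ : (w : Word n) → All (Inactive zero) (List.map ↑ (List.map ↑ w))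
  inactive-↑↑ [] = []
  inactive-↑↑ (un k ∷ w) = (refl , refl) ∷ inactive-↑↑ w
  inactive-↑↑ (bar k ∷ w) = (refl , refl) ∷ inactive-↑↑ w

  εʷ-core : ∀ k₁ k₂ v → εʷ zero (word (k₁ ∷ k₂ ∷ v)) ≡ εʷ zero (core k₁ k₂)
  εʷ-core k₁ k₂ v = trans (cong (εʷ zero) (word-core k₁ k₂ v))
    (εʷ-drop zero (heads k₁ k₂) _ (inactive-↑↑ (word v)))

  φʷ-core : ∀ k₁ k₂ v → φʷ zero (word (k₁ ∷ k₂ ∷ v)) ≡ φʷ zero (core k₁ k₂)
  φʷ-core k₁ k₂ v = trans (cong (φʷ zero) (word-core k₁ k₂ v))
    (φʷ-drop zero (heads k₁ k₂) _ (inactive-↑↑ (word v)))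

  F-core : ∀ {k₁ k₂ k₁′ k₂′} → Row k₁ k₂ k₁′ k₂′ →
           length (heads k₁ k₂) ≡ length (heads k₁′ k₂′) ×
           F zero (core k₁ k₂) (core k₁′ k₂′)
  F-core UN = refl , F-complete _ _ refl
  F-core ND = refl , F-complete _ _ refl
  F-core UD = refl , F-complete _ _ refl
  F-core NB = refl , F-complete _ _ refl
  F-core UB = refl , F-complete _ _ refl
  F-core BD = refl , F-complete _ _ refl

  Row-φ : ∀ k₁ k₂ → 0 < φʷ zero (core k₁ k₂) → ∃[ k₁′ ] ∃[ k₂′ ] Row k₁ k₂ k₁′ k₂′
  Row-φ U N _ = _ , _ , UN
  Row-φ N D _ = _ , _ , ND
  Row-φ U D _ = _ , _ , UD
  Row-φ N B _ = _ , _ , NB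
  Row-φ U B _ = _ , _ , UB
  Row-φ B D _ = _ , _ , BD
  Row-φ N N ()
  Row-φ D N ()
  Row-φ N U ()
  Row-φ D U ()
  Row-φ B N ()
  Row-φ B U ()

  Row-ε : ∀ k₁ k₂ → 0 < εʷ zero (core k₁ k₂) → ∃[ k₁′ ] ∃[ k₂′ ] Row k₁′ k₂′ k₁ k₂
  Row-ε N U _ = _ , _ , UN
  Row-ε D N _ = _ , _ , ND
  Row-ε N B _ = _ , _ , UD
  Row-ε D U _ = _ , _ , NB
  Row-ε B U _ = _ , _ , UB
  Row-ε D B _ = _ , _ , BD
  Row-ε U N ()
  Row-ε B N ()
  Row-ε U D ()
  Row-ε B D ()
  Row-ε U B ()
  Row-ε B B ()

Move-F : ∀ {n i} {v v′ : Config n} → Move i v v′ → F i (word v) (word v′)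
Move-F last = F-complete _ _ refl
Move-F (pair {k₁ = k₁} {k₂} {k₁′} {k₂′} {v} r) =
  subst₂ (F zero) (sym (word-core k₁ k₂ v)) (sym (word-core k₁′ k₂′ v))
    (F-insert zero {heads k₁ k₂} {tails k₁ k₂} {heads k₁′ k₂′} {tails k₁′ k₂′}
      (inactive-↑↑ (word v)) (proj₁ (F-core r)) (proj₂ (F-core r)))
Move-F (there {i = i} {k} {v} {v′} m) = F-there i k {v} {v′} (Move-F m)

Move-φ : ∀ {n} (i : Fin n) v → 0 < φʷ i (word v) → ∃[ v′ ] Move i v v′
Move-φ zero (U ∷ []) _ = _ , last
Move-φ zero (N ∷ []) ()
Move-φ zero (D ∷ []) ()
Move-φ zero (k₁ ∷ k₂ ∷ v) pos =
  let _ , _ , r = Row-φ k₁ k₂ (subst (0 <_) (φʷ-core k₁ k₂ v) pos) in _ , pair r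
Move-φ (suc i) (k ∷ v) pos =
  let _ , m = Move-φ i v (subst (0 <_) (φʷ-there i k v) pos) in _ , there m

Move-ε : ∀ {n} (i : Fin n) v → 0 < εʷ i (word v) → ∃[ v′ ] Move i v′ v
Move-ε zero (D ∷ []) _ = _ , last
Move-ε zero (U ∷ []) ()
Move-ε zero (B ∷ []) ()
Move-ε zero (k₁ ∷ k₂ ∷ v) pos =
  let _ , _ , r = Row-ε k₁ k₂ (subst (0 <_) (εʷ-core k₁ k₂ v) pos) in _ , pair r
Move-ε (suc i) (k ∷ v) pos =
  let _ , m = Move-ε i v (subst (0 <_) (εʷ-there i k v) pos) in _ , there m

-- Since the operator acts, φ is positive and some move exists; that move realises `F` as well, so
-- determinism identifies the two results without inverting `F` on a concatenation.
F-word : ∀ {n i} (v : Config n) {w} → F i (word v) w → ∃[ v′ ] w ≡ word v′ × Move i v v′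
F-word {i = i} v r with Move-φ i v (subst (0 <_) (sym (F-φ i r)) (s≤s z≤n))
... | v′ , m = v′ , F-deterministic i r (Move-F m) , m

F-word⁻ : ∀ {n i} (v : Config n) {w} → F i w (word v) → ∃[ v′ ] w ≡ word v′ × Move i v′ v
F-word⁻ {i = i} v r with Move-ε i v (subst (0 <_) (sym (F-ε i r)) (s≤s z≤n))
... | v′ , m = v′ , F-injective i r (Move-F m) , m

-- Ballot sequences and two-column tableaux

-- Reading the alphabet in order, g counts the letters of the second column
-- in excess of those of the first; nothing if this ever becomes negative.
tick : Bool → Bool → ℕ → Maybe ℕ
tick false false g       = just g
tick false true  g       = just (suc g)
tick true  true  g       = just g
tick true  false zero    = nothing
tick true  false (suc g) = just g

ballot : ∀ {n} → Config n → Config n → ℕ → Maybe ℕ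
ballot []            []              g = just g
ballot ((u , b) ∷ v) ((u′ , b′) ∷ v′) g =
  tick u u′ g >>= λ g → ballot v v′ g >>= tick b b′

tick₂ : Bool → Bool → Bool → Bool → ℕ → Maybe ℕ
tick₂ l₁ r₁ l₂ r₂ g = tick l₁ r₁ g >>= tick l₂ r₂

-- The unbarred letters of two adjacent indices are neighbours in the alphabet, and so are the
-- barred ones in reverse order. The two indices thus contribute one block on each side of the inner
-- count.
ballot-pair : ∀ {n} k₁ k₂ m₁ m₂ (d c : Config n) g →
  ballot (leftConfig (k₁ ∷ k₂ ∷ d)) (rightConfig (m₁ ∷ m₂ ∷ c)) g ≡
  (tick₂ (leftUn k₁ (wait k₂ (excess d))) (proj₁ m₁) (leftUn k₂ (excess d)) (proj₁ m₂) g >>= λ g →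
   ballot (leftConfig d) (rightConfig c) g >>=
   tick₂ (proj₂ k₂) (rightBar m₂ (excess c)) (proj₂ k₁) (rightBar m₁ (wait m₂ (excess c))))
ballot-pair k₁ k₂ m₁ m₂ d c g with tick (leftUn k₁ (wait k₂ (excess d))) (proj₁ m₁) g
... | nothing = refl
... | just g₁ with tick (leftUn k₂ (excess d)) (proj₁ m₂) g₁
...   | nothing = refl
...   | just g₂ with ballot (leftConfig d) (rightConfig c) g₂
...     | nothing = refl
...     | just g₃ = refl

-- Only the value between the two letters changes. The sole case in which that matters is g = 0 with
-- r₁ false and r₂ true: the early letter finds no partner, the late one does. The hypothesis
-- excludes it.
tick₂-swapˡ : ∀ {r₁ r₂} → r₂ ≤ᵇ r₁ → ∀ g → tick₂ true r₁ false r₂ g ≡ tick₂ false r₁ true r₂ g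
tick₂-swapˡ f≤t         g       = refl
tick₂-swapˡ (b≤b {true}) g       = refl
tick₂-swapˡ (b≤b {false}) zero    = refl
tick₂-swapˡ (b≤b {false}) (suc g) = refl

-- Here the excluded case is g = 0 with l₁ true and l₂ false, where the letter of r would come too
-- late.
tick₂-swapʳ : ∀ {l₁ l₂} → l₁ ≤ᵇ l₂ → ∀ g → tick₂ l₁ true l₂ false g ≡ tick₂ l₁ false l₂ true g
tick₂-swapʳ f≤t           g       = refl
tick₂-swapʳ (b≤b {false}) g       = refl
tick₂-swapʳ (b≤b {true})  zero    = refl
tick₂-swapʳ (b≤b {true})  (suc g) = refl

-- Local effect of a move on the halves of a split column

data Swap (P : Set) : (a b a′ b′ : Bool) → Set where
  keep : ∀ {a b} → Swap P a b a b
  swap : P → Swap P true false false true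

tick₂-Swapˡ : ∀ {P a b a′ b′ r₁ r₂} → Swap P a b a′ b′ → (P → r₂ ≤ᵇ r₁) →
              ∀ g → tick₂ a r₁ b r₂ g ≡ tick₂ a′ r₁ b′ r₂ g
tick₂-Swapˡ keep     _  g = refl
tick₂-Swapˡ (swap p) le g = tick₂-swapˡ (le p) g

tick₂-Swapʳ : ∀ {P a b a′ b′ l₁ l₂} → Swap P a b a′ b′ → (P → l₁ ≤ᵇ l₂) →
              ∀ g → tick₂ l₁ a l₂ b g ≡ tick₂ l₁ a′ l₂ b′ g
tick₂-Swapʳ keep     _  g = refl
tick₂-Swapʳ (swap p) le g = tick₂-swapʳ (le p) g

module _ {n : ℕ} where

  φ² ε² : Kind → Kind → ℕ
  φ² k₁ k₂ = φʷ zero (core {n} k₁ k₂)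
  ε² k₁ k₂ = εʷ zero (core {n} k₁ k₂)

  -- The row `UD`, the only one with φ = 2, leaves the left half fixed. Whether `h` is zero matters
  -- for `N`, which counts as present in the left half exactly when a pair is waiting.
  Row-left : ∀ {k₁ k₂ k₁′ k₂′} → Row k₁ k₂ k₁′ k₂′ → ∀ h →
    Swap (φ² k₁ k₂ ≡ 1) (leftUn k₁ (wait k₂ h)) (leftUn k₂ h)
                        (leftUn k₁′ (wait k₂′ h)) (leftUn k₂′ h) ×
    Swap (φ² k₁ k₂ ≡ 1) (proj₂ k₂) (proj₂ k₁) (proj₂ k₂′) (proj₂ k₁′)
  Row-left UN zero    = swap refl , keep
  Row-left UN (suc h) = keep , keep
  Row-left ND zero    = keep , swap refl
  Row-left ND (suc h) = swap refl , swap refl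
  Row-left UD h       = keep , keep
  Row-left NB h       = swap refl , swap refl
  Row-left UB h       = swap refl , swap refl
  Row-left BD h       = keep , keep

  -- The row `NB`, the only one with ε = 1 at its source, leaves the right half fixed.
  Row-right : ∀ {k₁ k₂ k₁′ k₂′} → Row k₁ k₂ k₁′ k₂′ → ∀ h →
    Swap (ε² k₁ k₂ ≡ 0) (proj₁ k₁) (proj₁ k₂) (proj₁ k₁′) (proj₁ k₂′) ×
    Swap (ε² k₁ k₂ ≡ 0) (rightBar k₂ h) (rightBar k₁ (wait k₂ h))
                        (rightBar k₂′ h) (rightBar k₁′ (wait k₂′ h))
  Row-right UN zero    = swap refl , keep
  Row-right UN (suc h) = swap refl , swap refl
  Row-right ND zero    = keep , swap refl
  Row-right ND (suc h) = keep , keep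
  Row-right UD h       = swap refl , swap refl
  Row-right NB h       = keep , keep
  Row-right UB h       = keep , keep
  Row-right BD h       = swap refl , swap refl

  ε²≡0 : ∀ k₁ k₂ → ε² k₁ k₂ ≡ 0 → ∀ h →
    proj₁ k₂ ≤ᵇ proj₁ k₁ × rightBar k₁ (wait k₂ h) ≤ᵇ rightBar k₂ h
  ε²≡0 N N _ zero    = b≤b , b≤b
  -- The only waiting pair is served at i + 1, and nothing is left for i.
  ε²≡0 N N _ (suc zero) = b≤b , f≤t
  ε²≡0 N N _ (suc (suc h)) = b≤b , b≤b
  ε²≡0 N D _ zero    = b≤b , f≤t
  ε²≡0 N D _ (suc h) = b≤b , b≤b
  ε²≡0 U N _ zero = f≤t , b≤b
  ε²≡0 U N _ (suc h) = f≤t , f≤t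
  ε²≡0 U U _ h = b≤b , b≤b
  ε²≡0 U D _ h = f≤t , f≤t
  ε²≡0 U B _ h = b≤b , b≤b
  ε²≡0 D D _ h = b≤b , b≤b
  ε²≡0 B N _ zero = f≤t , b≤b
  ε²≡0 B N _ (suc h) = f≤t , f≤t
  ε²≡0 B D _ h = f≤t , f≤t
  ε²≡0 B B _ h = b≤b , b≤b

  φ²≡0 : ∀ k₁ k₂ → φ² k₁ k₂ ≡ 0 → ∀ h →
    leftUn k₁ (wait k₂ h) ≤ᵇ leftUn k₂ h × proj₂ k₂ ≤ᵇ proj₂ k₁
  φ²≡0 N N _ zero    = b≤b , b≤b
  φ²≡0 N N _ (suc zero) = f≤t , b≤b
  φ²≡0 N N _ (suc (suc h)) = b≤b , b≤b
  φ²≡0 N U _ zero    = f≤t , b≤b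
  φ²≡0 N U _ (suc h) = b≤b , b≤b
  φ²≡0 D N _ zero    = b≤b , f≤t
  φ²≡0 D N _ (suc h) = f≤t , f≤t
  φ²≡0 D U _ h = f≤t , f≤t
  φ²≡0 U U _ h = b≤b , b≤b
  φ²≡0 D D _ h = b≤b , b≤b
  φ²≡0 B N _ zero    = b≤b , f≤t
  φ²≡0 B N _ (suc h) = f≤t , f≤t
  φ²≡0 B U _ h = f≤t , f≤t
  φ²≡0 D B _ h = b≤b , b≤b
  φ²≡0 B B _ h = b≤b , b≤b
  φ²≡0 U D ()
  φ²≡0 U B ()

>>=-cong : ∀ {A B : Set} {m m′ : Maybe A} {K L : A → Maybe B} →
           m ≡ m′ → (∀ x → K x ≡ L x) → (m >>= K) ≡ (m′ >>= L)
>>=-cong {m = nothing} refl eq = refl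
>>=-cong {m = just x}  refl eq = eq x

-- If the left half of `v` changes then φ(v) = 1, so ε(c) = 0, and `ε²≡0` makes the right half of
-- `c` monotone where `tick₂-swapˡ` needs it.
ballot-left : ∀ {n i} {v v′ : Config n} (c : Config n) → Move i v v′ →
              εʷ i (word c) < φʷ i (word v) → ∀ g →
              ballot (leftConfig v) (rightConfig c) g ≡ ballot (leftConfig v′) (rightConfig c) g
-- For i = n the letters n and n̄ are neighbours in the alphabet, so a single swap across its middle
-- is enough.
ballot-left (U ∷ []) last lt g = tick₂-swapˡ f≤t g
ballot-left (N ∷ []) last lt g = tick₂-swapˡ {false} b≤b g
ballot-left (B ∷ []) last lt g = tick₂-swapˡ f≤t g
ballot-left (D ∷ []) last (s≤s ()) g
ballot-left (m₁ ∷ m₂ ∷ c) (pair {k₁ = k₁} {k₂} {k₁′} {k₂′} {v} r) lt g = begin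
  ballot (leftConfig (k₁ ∷ k₂ ∷ v)) (rightConfig (m₁ ∷ m₂ ∷ c)) g
    ≡⟨ ballot-pair k₁ k₂ m₁ m₂ v c g ⟩
  _
    ≡⟨ >>=-cong (tick₂-Swapˡ (proj₁ (Row-left r h)) (λ p → proj₁ (late p)) g)
         (λ g → >>=-cong {m = ballot (leftConfig v) (rightConfig c) g} refl
           (tick₂-Swapˡ (proj₂ (Row-left r h)) (λ p → proj₂ (late p)))) ⟩
  _
    ≡⟨ ballot-pair k₁′ k₂′ m₁ m₂ v c g ⟨
  ballot (leftConfig (k₁′ ∷ k₂′ ∷ v)) (rightConfig (m₁ ∷ m₂ ∷ c)) g ∎
  where
  open ≡-Reasoning
  h = excess v
  lt² : ε² m₁ m₂ < φ² k₁ k₂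
  lt² = subst₂ _<_ (εʷ-core m₁ m₂ c) (φʷ-core k₁ k₂ v) lt
  late : φ² k₁ k₂ ≡ 1 → _
  late p = ε²≡0 m₁ m₂ (ℕ.n<1⇒n≡0 (subst (ε² m₁ m₂ <_) p lt²)) (excess c)
-- The queue that arrives at `k` is the same before and after the move, hence so are the two ticks
-- there.
ballot-left (m ∷ c) (there {i = i} {k} {v} {v′} r) lt g rewrite sym (Move-excess r) =
  >>=-cong {m = tick (leftUn k (excess v)) (proj₁ m) g} refl λ g →
  >>=-cong {K = tick _ _} (ballot-left c r (subst₂ _<_ (εʷ-there i m c) (φʷ-there i k v) lt) g) λ _ → refl

-- Dually, a change of the right half of `v` needs ε(v) = 0, so φ(d) = 0 and `φ²≡0` applies to the
-- left half of `d`.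
ballot-right : ∀ {n i} {v v′ : Config n} (d : Config n) → Move i v v′ →
               φʷ i (word d) ≤ εʷ i (word v) → ∀ g →
               ballot (leftConfig d) (rightConfig v) g ≡ ballot (leftConfig d) (rightConfig v′) g
ballot-right (D ∷ []) last le g = tick₂-swapʳ f≤t g
ballot-right (N ∷ []) last le g = tick₂-swapʳ {false} b≤b g
ballot-right (B ∷ []) last le g = tick₂-swapʳ f≤t g
ballot-right (U ∷ []) last () g
ballot-right (m₁ ∷ m₂ ∷ d) (pair {k₁ = k₁} {k₂} {k₁′} {k₂′} {v} r) le g = begin
  ballot (leftConfig (m₁ ∷ m₂ ∷ d)) (rightConfig (k₁ ∷ k₂ ∷ v)) g
    ≡⟨ ballot-pair m₁ m₂ k₁ k₂ d v g ⟩
  _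
    ≡⟨ >>=-cong (tick₂-Swapʳ (proj₁ (Row-right r h)) (λ p → proj₁ (late p)) g)
         (λ g → >>=-cong {m = ballot (leftConfig d) (rightConfig v) g} refl
           (tick₂-Swapʳ (proj₂ (Row-right r h)) (λ p → proj₂ (late p)))) ⟩
  _
    ≡⟨ ballot-pair m₁ m₂ k₁′ k₂′ d v g ⟨
  ballot (leftConfig (m₁ ∷ m₂ ∷ d)) (rightConfig (k₁′ ∷ k₂′ ∷ v)) g ∎
  where
  open ≡-Reasoning
  h = excess v
  le² : φ² m₁ m₂ ≤ ε² k₁ k₂
  le² = subst₂ _≤_ (φʷ-core m₁ m₂ d) (εʷ-core k₁ k₂ v) le
  late : ε² k₁ k₂ ≡ 0 → _
  late p = φ²≡0 m₁ m₂ (ℕ.n≤0⇒n≡0 (subst (φ² m₁ m₂ ≤_) p le²)) (excess d)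
ballot-right (m ∷ d) (there {i = i} {k} {v} {v′} r) le g rewrite sym (Move-excess r) =
  >>=-cong {m = tick (leftUn m (excess d)) (proj₁ k) g} refl λ g →
  >>=-cong {K = tick _ _} (ballot-right d r (subst₂ _≤_ (φʷ-there i m d) (εʷ-there i k v) le) g) λ _ → refl

-- Words in increasing order

AllPairs-unique : ∀ {A : Set} {_≺_ : Rel A 0ℓ} → Asymmetric _≺_ → ∀ {xs ys : List A} →
  AllPairs _≺_ xs → AllPairs _≺_ ys →
  (∀ {x} → x ∈ xs → x ∈ ys) → (∀ {x} → x ∈ ys → x ∈ xs) → xs ≡ ys
AllPairs-unique asym [] [] p q = refl
AllPairs-unique asym [] (_ ∷ _) p q with () ← q (here refl)
AllPairs-unique asym (_ ∷ _) [] p q with () ← p (here refl)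
AllPairs-unique {_≺_ = _≺_} asym {x ∷ xs} {y ∷ ys} (ax ∷ sx) (ay ∷ sy) p q =
  heads≡ (p (here refl)) (q (here refl))
  where
  heads≡ : x ∈ y ∷ ys → y ∈ x ∷ xs → x ∷ xs ≡ y ∷ ys
  heads≡ (there x∈) (there y∈) = ⊥-elim (asym (All.lookup ax y∈) (All.lookup ay x∈))
  heads≡ (there x∈) (here refl) = ⊥-elim (asym (All.lookup ay x∈) (All.lookup ay x∈))
  heads≡ (here refl) _ = cong (x ∷_) (AllPairs-unique asym sx sy
    (λ z∈ → drop (All.lookup ax z∈) (p (there z∈)))
    (λ z∈ → drop (All.lookup ay z∈) (q (there z∈))))
    where
    drop : ∀ {z zs} → x ≺ z → z ∈ x ∷ zs → z ∈ zs
    drop x≺z (here refl) = ⊥-elim (asym x≺z x≺z)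
    drop x≺z (there z∈) = z∈

filter-map : ∀ {A B : Set} {P : B → Set} (P? : Decidable P) (g : A → B) xs →
             filter P? (List.map g xs) ≡ List.map g (filter (P? ∘ g) xs)
filter-map P? g [] = refl
filter-map P? g (x ∷ xs) with does (P? (g x))
... | true  = cong (g x ∷_) (filter-map P? g xs)
... | false = filter-map P? g xs

filter-slot : ∀ {A : Set} {P : A → Set} (P? : Decidable P) x xs →
              filter P? (x ∷ xs) ≡ slot (does (P? x)) x ++ filter P? xs
filter-slot P? x xs with does (P? x)
... | true  = refl
... | false = refl

allFin-suc : ∀ n → allFin (suc n) ≡ zero ∷ List.map suc (allFin n)
allFin-suc n = cong (zero ∷_) (sym (List.map-tabulate id suc))

descending-suc : ∀ n → descending (suc n) ≡ List.map suc (descending n) ++ zero ∷ []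
descending-suc n = begin
  reverse (allFin (suc n))                      ≡⟨ cong reverse (allFin-suc n) ⟩
  reverse (zero ∷ List.map suc (allFin n))      ≡⟨ List.unfold-reverse zero (List.map suc (allFin n)) ⟩
  reverse (List.map suc (allFin n)) ++ zero ∷ [] ≡⟨ cong (_++ zero ∷ []) (List.reverse-map suc (allFin n)) ⟨
  List.map suc (descending n) ++ zero ∷ [] ∎
  where open ≡-Reasoning

∈-descending : ∀ {n} (k : Fin n) → k ∈ descending n
∈-descending {suc n} k rewrite descending-suc n with k
... | zero  = ∈-++⁺ʳ _ (here refl)
... | suc k = ∈-++⁺ˡ (∈-map⁺ suc (∈-descending k))

descending-sorted : ∀ n → AllPairs Fin._>_ (descending n)
descending-sorted zero = []
descending-sorted (suc n) rewrite descending-suc n =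
  AllPairs.++⁺ (AllPairs.map⁺ (AllPairs.map s≤s (descending-sorted n)))
    ([] ∷ []) (All.map⁺ (All.universal (λ _ → s≤s z≤n ∷ []) _))

alphabet : ∀ n → Word n
alphabet n = List.map inj₁ (allFin n) ++ List.map inj₂ (descending n)

alphabet-suc : ∀ n → alphabet (suc n) ≡ un zero ∷ List.map ↑ (alphabet n) ++ bar zero ∷ []
alphabet-suc n = begin
  List.map inj₁ (allFin (suc n)) ++ List.map inj₂ (descending (suc n))
    ≡⟨ cong₂ _++_ (cong (List.map inj₁) (allFin-suc n))
         (trans (cong (List.map inj₂) (descending-suc n))
                (List.map-++ inj₂ (List.map suc (descending n)) _)) ⟩
  un zero ∷ List.map inj₁ (List.map suc (allFin n)) ++
    (List.map inj₂ (List.map suc (descending n)) ++ bar zero ∷ [])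
    ≡⟨ cong (un zero ∷_) (cong₂ (λ x y → x ++ y ++ bar zero ∷ [])
         (lift inj₁ (allFin n) (λ _ → refl)) (lift inj₂ (descending n) (λ _ → refl))) ⟩
  un zero ∷ List.map ↑ (List.map inj₁ (allFin n)) ++
    (List.map ↑ (List.map inj₂ (descending n)) ++ bar zero ∷ [])
    ≡⟨ cong (un zero ∷_) (sym (List.++-assoc (List.map ↑ (List.map inj₁ (allFin n))) _ _)) ⟩
  un zero ∷ (List.map ↑ (List.map inj₁ (allFin n)) ++
             List.map ↑ (List.map inj₂ (descending n))) ++ bar zero ∷ []
    ≡⟨ cong (λ z → un zero ∷ z ++ bar zero ∷ []) (List.map-++ ↑ (List.map inj₁ (allFin n)) _) ⟨
  un zero ∷ List.map ↑ (alphabet n) ++ bar zero ∷ [] ∎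
  where
  open ≡-Reasoning
  lift : ∀ {m} (ι : ∀ {n} → Fin n → Letter n) (ks : List (Fin m)) → (∀ k → ι (suc k) ≡ ↑ (ι k)) →
         List.map ι (List.map suc ks) ≡ List.map ↑ (List.map ι ks)
  lift ι ks eq = trans (sym (List.map-∘ ks)) (trans (List.map-cong eq ks) (List.map-∘ ks))

∈-alphabet : ∀ {n} (x : Letter n) → x ∈ alphabet n
∈-alphabet (un k)  = ∈-++⁺ˡ (∈-map⁺ inj₁ (∈-allFin k))
∈-alphabet (bar k) = ∈-++⁺ʳ _ (∈-map⁺ inj₂ (∈-descending k))

<ˡ-asym : ∀ {n} → Asymmetric (_<ˡ_ {n})
<ˡ-asym = ⊎-<-asymmetric ℕ.<-asym ℕ.<-asym

<ˡ-trans : ∀ {n} {x y z : Letter n} → x <ˡ y → y <ˡ z → x <ˡ z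
<ˡ-trans = ⊎-<-transitive ℕ.<-trans (flip ℕ.<-trans)

alphabet-sorted : ∀ n → AllPairs _<ˡ_ (alphabet n)
alphabet-sorted n = AllPairs.++⁺
  (AllPairs.map⁺ (AllPairs.tabulate⁺-< ₁∼₁))
  (AllPairs.map⁺ (AllPairs.map ₂∼₂ (descending-sorted n)))
  (All.map⁺ (All.universal (λ _ → All.map⁺ (All.universal (λ _ → ₁∼₂) _)) _))

has : ∀ {n} → Config n → Letter n → Bool
has v (un k)  = proj₁ (lookup v k)
has v (bar k) = proj₂ (lookup v k)

config : ∀ {n} → (Letter n → Bool) → Config n
config χ = tabulate λ k → χ (un k) , χ (bar k)

filter-alphabet : ∀ {n} {P : Letter n → Set} (P? : Decidable P) →
                  filter P? (alphabet n) ≡ word (config (does ∘ P?))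
filter-alphabet {zero} P? = refl
filter-alphabet {suc n} P? = begin
  filter P? (alphabet (suc n))
    ≡⟨ cong (filter P?) (alphabet-suc n) ⟩
  filter P? (un zero ∷ List.map ↑ (alphabet n) ++ bar zero ∷ [])
    ≡⟨ filter-slot P? (un zero) _ ⟩
  first ++ filter P? (List.map ↑ (alphabet n) ++ bar zero ∷ [])
    ≡⟨ cong (first ++_) (List.filter-++ P? (List.map ↑ (alphabet n)) _) ⟩
  first ++ filter P? (List.map ↑ (alphabet n)) ++ filter P? (bar zero ∷ [])
    ≡⟨ cong₂ (λ x y → first ++ x ++ y)
         (trans (filter-map P? ↑ (alphabet n)) (cong (List.map ↑) (filter-alphabet (P? ∘ ↑))))
         (trans (filter-slot P? (bar zero) []) (List.++-identityʳ _)) ⟩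
  word (config (does ∘ P?)) ∎
  where
  open ≡-Reasoning
  first = slot (does (P? (un zero))) (un zero)

config-has : ∀ {n} (v : Config n) → config (has v) ≡ v
config-has v = Vec.tabulate∘lookup v

word-filter : ∀ {n} (v : Config n) → word v ≡ filter (T? ∘ has v) (alphabet n)
word-filter v = sym (trans (filter-alphabet (T? ∘ has v)) (cong word (config-has v)))

word-increasing : ∀ {n} (v : Config n) → Linked _<ˡ_ (word v)
word-increasing v rewrite word-filter v =
  Linked.AllPairs⇒Linked (AllPairs.filter⁺ (T? ∘ has v) (alphabet-sorted _))

∈-word : ∀ {n} (v : Config n) {x} → x ∈ word v ⇔ T (has v x)
∈-word v {x} rewrite word-filter v = mk⇔
  (λ x∈ → proj₂ (∈-filter⁻ (T? ∘ has v) {xs = alphabet _} x∈))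
  (∈-filter⁺ (T? ∘ has v) (∈-alphabet x))

contents : ∀ {n} → Word n → Config n
contents w = config λ x → does (x ∈? w)

contents-unique : ∀ {n} {w : Word n} (v : Config n) →
                  (∀ x → x ∈ w ⇔ T (has v x)) → contents w ≡ v
contents-unique {w = w} v iff = trans
  (Vec.tabulate-cong λ k → cong₂ _,_ (does-⇔ (iff (un k)) (un k ∈? w) (T? _))
                                      (does-⇔ (iff (bar k)) (bar k ∈? w) (T? _)))
  (config-has v)

contents-word : ∀ {n} (v : Config n) → contents (word v) ≡ v
contents-word v = contents-unique v λ _ → ∈-word v

arrange-word : ∀ {n} (w : Word n) → arrange w ≡ word (contents w)
arrange-word w = filter-alphabet (_∈? w)

arrange-increasing : ∀ {n} {w : Word n} → Linked _<ˡ_ w → arrange w ≡ w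
arrange-increasing {w = w} inc = AllPairs-unique <ˡ-asym
  (AllPairs.filter⁺ (_∈? w) (alphabet-sorted _)) (Linked.Linked⇒AllPairs <ˡ-trans inc)
  (λ x∈ → proj₂ (∈-filter⁻ (_∈? w) {xs = alphabet _} x∈))
  (λ {x} x∈ → ∈-filter⁺ (_∈? w) (∈-alphabet x) x∈)

word-contents : ∀ {n} {w : Word n} → Linked _<ˡ_ w → word (contents w) ≡ w
word-contents {w = w} inc = trans (sym (arrange-word w)) (arrange-increasing inc)

-- Splitting a column

module _ {n : ℕ} {P : Fin n → Set} (P? : ∀ k → Dec (P k)) where

  greatest-just : ∀ {k} → P k → (∀ t → P t → t Fin.≤ k) → greatest P? ≡ just k
  greatest-just {k} pk max = go (descending n) (descending-sorted n) (∈-descending k)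
    where
    go : ∀ xs → AllPairs Fin._>_ xs → k ∈ xs → head (filter P? xs) ≡ just k
    go (x ∷ xs) (_ ∷ _) (here refl) rewrite List.filter-accept P? {xs = xs} pk = refl
    go (x ∷ xs) (x> ∷ sorted) (there k∈) with P? x
    ... | yes px = ⊥-elim (ℕ.≤⇒≯ (max x px) (All.lookup x> k∈))
    ... | no  _  = go xs sorted k∈

  greatest-nothing : (∀ t → ¬ P t) → greatest P? ≡ nothing
  greatest-nothing ¬p rewrite List.filter-none P? (All.universal ¬p (descending n)) = refl

-- The queue along the descending list of indices

waitAll : ∀ {n} → (Fin n → Kind) → ℕ → List (Fin n) → ℕ
waitAll κ h []       = h
waitAll κ h (k ∷ ks) = waitAll κ (wait (κ k) h) ks

releases : Kind → ℕ → Bool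
releases N h = positive h
releases U h = false
releases D h = false
releases B h = false

-- The absent indices met while a pair is waiting: these are the t's, in the order in which `choose`
-- finds them.
released : ∀ {n} → (Fin n → Kind) → ℕ → List (Fin n) → List (Fin n)
released κ h []       = []
released κ h (k ∷ ks) = slot (releases (κ k) h) k ++ released κ (wait (κ k) h) ks

module _ {n : ℕ} (C : Word n) where

  data View (k : Fin n) : Kind → Set where
    both    : un k ∈ C → bar k ∈ C → View k B
    neither : un k ∉ C → bar k ∉ C → View k N
    onlyUn  : un k ∈ C → bar k ∉ C → View k U
    onlyBar : un k ∉ C → bar k ∈ C → View k D

  data Outcome (m : Maybe (List (Fin n × Fin n))) (h : ℕ) (ts : List (Fin n)) : Set where
    success : ∀ s → m ≡ just s → h ≡ 0 → List.map proj₂ s ≡ ts → Outcome m h ts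
    failure : m ≡ nothing → h ≢ 0 → Outcome m h ts

  pair? : ∀ k → Dec (un k ∈ C × bar k ∈ C)
  pair? k = (un k ∈? C) ×-dec (bar k ∈? C)

  Candidate : ℕ → Fin n → Fin n → Set
  Candidate b z t = toℕ t < b × t Fin.< z × un t ∉ C × bar t ∉ C

  candidate? : ∀ b z t → Dec (Candidate b z t)
  candidate? b z t = (toℕ t <? b) ×-dec (t Fin.<? z) ×-dec ¬? (un t ∈? C) ×-dec ¬? (bar t ∈? C)

  choose-just : ∀ {b z t} zs → greatest (candidate? b z) ≡ just t →
                choose C b (z ∷ zs) ≡ Maybe.map ((z , t) ∷_) (choose C (toℕ t) zs)
  choose-just zs eq rewrite eq = refl

  choose-nothing : ∀ {b z} zs → greatest (candidate? b z) ≡ nothing →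
                   choose C b (z ∷ zs) ≡ nothing
  choose-nothing zs eq rewrite eq = refl

  choose-proj₁ : ∀ b zs {s} → choose C b zs ≡ just s → List.map proj₁ s ≡ zs
  choose-proj₁ b [] refl = refl
  choose-proj₁ b (z ∷ zs) eq with greatest (candidate? b z)
  ... | just t with choose C (toℕ t) zs in eq′
  choose-proj₁ b (z ∷ zs) refl | just t | just s = cong (z ∷_) (choose-proj₁ (toℕ t) zs eq′)

  module _ (κ : Fin n → Kind) (view : ∀ k → View k (κ k)) where

    -- ks is what remains of the descending list of indices, and the queue q
    -- consists of the z's already met to which no t has been assigned.
    choose-queue : ∀ b q ks → AllPairs Fin._>_ ks →
      (∀ {t k} → k ∈ ks → t Fin.< k → t ∈ ks) →
      All (λ k → toℕ k < b) ks → All (λ z → All (Fin._< z) ks) q →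
      (∀ {z q′} → q ≡ z ∷ q′ → ∀ {t} → Candidate b z t → t ∈ ks) →
      Outcome (choose C b (q ++ filter pair? ks))
              (waitAll κ (length q) ks) (released κ (length q) ks)
    choose-queue b [] [] _ _ _ _ _ = success [] refl refl refl
    -- No index is left, so the head of the queue has no candidate and `choose` fails.
    choose-queue b (z ∷ q) [] _ _ _ _ cand = failure
      (choose-nothing (q ++ []) (greatest-nothing (candidate? b z) λ t c → nil (cand refl c))) λ ()
      where
      nil : ∀ {t : Fin n} → ¬ t ∈ []
      nil ()
    choose-queue b q (k ∷ ks) (k> ∷ sorted) closed (k<b ∷ ks<b) <q cand = by-kind (κ k) (view k)
      where
      drop : ∀ {t} → t ∈ k ∷ ks → t ≢ k → t ∈ ks
      drop (here t≡k) t≢k = ⊥-elim (t≢k t≡k)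
      drop (there t∈) _   = t∈

      below : ∀ {t} → t Fin.< k → t ∈ ks
      below t<k = drop (closed (here refl) t<k) (Fin.<⇒≢ t<k)

      closed′ : ∀ {t j} → j ∈ ks → t Fin.< j → t ∈ ks
      closed′ j∈ t<j = below (ℕ.<-trans t<j (All.lookup k> j∈))

      by-kind : ∀ κₖ → View k κₖ →
        Outcome (choose C b (q ++ filter pair? (k ∷ ks)))
                (waitAll κ (wait κₖ (length q)) ks)
                (slot (releases κₖ (length q)) k ++ released κ (wait κₖ (length q)) ks)
      by-kind B (both u∈ b∈) rewrite List.filter-accept pair? {xs = ks} (u∈ , b∈)
        | sym (List.++-assoc q (k ∷ []) (filter pair? ks))
        | sym (trans (List.length-++ q {k ∷ []}) (ℕ.+-comm (length q) 1)) =
        choose-queue b (q ++ k ∷ []) ks sorted closed′ ks<b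
          (All.++⁺ (All.map All.tail <q) (k> ∷ []))
          (cand′ q cand)
        where
        cand′ : ∀ q → (∀ {z q′} → q ≡ z ∷ q′ → ∀ {t} → Candidate b z t → t ∈ k ∷ ks) →
                ∀ {z q′} → q ++ k ∷ [] ≡ z ∷ q′ → ∀ {t} → Candidate b z t → t ∈ ks
        -- The queue was empty and k becomes its head, so its candidates lie below k.
        cand′ []      _    refl (_ , t<k , _) = below t<k
        cand′ (_ ∷ _) cand refl c@(_ , _ , u∉ , _) = drop (cand refl c) λ { refl → u∉ u∈ }
      by-kind U (onlyUn u∈ b∉) rewrite List.filter-reject pair? {xs = ks} (b∉ ∘ proj₂) =
        choose-queue b q ks sorted closed′ ks<b (All.map All.tail <q)
          λ eq c → drop (cand eq c) λ { refl → proj₁ (proj₂ (proj₂ c)) u∈ }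
      by-kind D (onlyBar u∉ b∈) rewrite List.filter-reject pair? {xs = ks} (u∉ ∘ proj₁) =
        choose-queue b q ks sorted closed′ ks<b (All.map All.tail <q)
          λ eq c → drop (cand eq c) λ { refl → proj₂ (proj₂ (proj₂ c)) b∈ }
      by-kind N (neither u∉ b∉) rewrite List.filter-reject pair? {xs = ks} (u∉ ∘ proj₁) =
        match q <q cand
        where
        match : ∀ q → All (λ z → All (Fin._< z) (k ∷ ks)) q →
          (∀ {z q′} → q ≡ z ∷ q′ → ∀ {t} → Candidate b z t → t ∈ k ∷ ks) →
          Outcome (choose C b (q ++ filter pair? ks)) (waitAll κ (wait N (length q)) ks)
                  (slot (positive (length q)) k ++ released κ (wait N (length q)) ks)
        match []       _                  _    = choose-queue b [] ks sorted closed′ ks<b [] λ ()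
        -- All candidates for z are still in the descending list, so its head k, which is absent and
        -- below z, is the greatest. It then becomes the bound for the next in the queue.
        match (z ∷ q′) ((k<z ∷ _) ∷ <q′) cand =
          extend (choose-queue (toℕ k) q′ ks sorted closed′ k> (All.map All.tail <q′)
            λ _ c → below (proj₁ c))
          where
          max : ∀ t → Candidate b z t → t Fin.≤ k
          max t c with cand refl c
          ... | here refl = ℕ.≤-refl
          ... | there t∈  = ℕ.<⇒≤ (All.lookup k> t∈)
          step : choose C b ((z ∷ q′) ++ filter pair? ks) ≡
                 Maybe.map ((z , k) ∷_) (choose C (toℕ k) (q′ ++ filter pair? ks))
          step = choose-just (q′ ++ filter pair? ks) (greatest-just (candidate? b z) (k<b , k<z , u∉ , b∉) max)
          extend : ∀ {h ts} → Outcome (choose C (toℕ k) (q′ ++ filter pair? ks)) h ts →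
                   Outcome (choose C b ((z ∷ q′) ++ filter pair? ks)) h (k ∷ ts)
          extend (success s eq h≡0 refl) =
            success ((z , k) ∷ s) (trans step (cong (Maybe.map _) eq)) h≡0 refl
          extend (failure eq h≢0) = failure (trans step (cong (Maybe.map _) eq)) h≢0

  kind : Fin n → Kind
  kind k = does (un k ∈? C) , does (bar k ∈? C)

  view : ∀ k → View k (kind k)
  view k with un k ∈? C | bar k ∈? C
  ... | yes u∈ | yes b∈ = both u∈ b∈
  ... | yes u∈ | no b∉  = onlyUn u∈ b∉
  ... | no u∉  | yes b∈ = onlyBar u∉ b∈
  ... | no u∉  | no b∉  = neither u∉ b∉

  split-outcome : Outcome (split C) (waitAll kind 0 (descending n)) (released kind 0 (descending n))
  split-outcome = choose-queue kind view n [] (descending n) (descending-sorted n)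
    (λ _ _ → ∈-descending _) (All.universal Fin.toℕ<n _) [] λ ()

waitAll-++ : ∀ {n} (κ : Fin n → Kind) h ks ls →
             waitAll κ h (ks ++ ls) ≡ waitAll κ (waitAll κ h ks) ls
waitAll-++ κ h []       ls = refl
waitAll-++ κ h (k ∷ ks) ls = waitAll-++ κ _ ks ls

waitAll-map : ∀ {n} (κ : Fin (suc n) → Kind) h ks →
              waitAll κ h (List.map suc ks) ≡ waitAll (κ ∘ suc) h ks
waitAll-map κ h []       = refl
waitAll-map κ h (k ∷ ks) = waitAll-map κ _ ks

released-++ : ∀ {n} (κ : Fin n → Kind) h ks ls →
              released κ h (ks ++ ls) ≡ released κ h ks ++ released κ (waitAll κ h ks) ls
released-++ κ h []       ls = refl
released-++ κ h (k ∷ ks) ls =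
  trans (cong (slot (releases (κ k) h) k ++_) (released-++ κ _ ks ls))
        (sym (List.++-assoc (slot (releases (κ k) h) k) _ _))

released-map : ∀ {n} (κ : Fin (suc n) → Kind) h ks →
               released κ h (List.map suc ks) ≡ List.map suc (released (κ ∘ suc) h ks)
released-map κ h [] = refl
released-map κ h (k ∷ ks) = trans (cong (slot (releases (κ (suc k)) h) (suc k) ++_) (released-map κ _ ks))
  (map-slot-++ (releases (κ (suc k)) h))
  where
  map-slot-++ : ∀ b {k ks} → slot b (suc k) ++ List.map suc ks ≡ List.map suc (slot b k ++ ks)
  map-slot-++ false = refl
  map-slot-++ true  = refl

-- A configuration is taken apart at index zero, which is the last entry of the descending list;
-- hence the passage through `descending-suc`.
excess-tabulate : ∀ {n} (κ : Fin n → Kind) → excess (tabulate κ) ≡ waitAll κ 0 (descending n)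
excess-tabulate {zero} κ = refl
excess-tabulate {suc n} κ = begin
  wait (κ zero) (excess (tabulate (κ ∘ suc)))
    ≡⟨ cong (wait (κ zero)) (excess-tabulate (κ ∘ suc)) ⟩
  wait (κ zero) (waitAll (κ ∘ suc) 0 (descending n))
    ≡⟨ cong (wait (κ zero)) (waitAll-map κ 0 (descending n)) ⟨
  wait (κ zero) (waitAll κ 0 (List.map suc (descending n)))
    ≡⟨ waitAll-++ κ 0 (List.map suc (descending n)) (zero ∷ []) ⟨
  waitAll κ 0 (List.map suc (descending n) ++ zero ∷ [])
    ≡⟨ cong (waitAll κ 0) (descending-suc n) ⟨
  waitAll κ 0 (descending (suc n)) ∎
  where open ≡-Reasoning

allReleased : ∀ {n} → (Fin n → Kind) → List (Fin n)
allReleased κ = released κ 0 (descending _)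

allReleased-suc : ∀ {n} (κ : Fin (suc n) → Kind) →
  allReleased κ ≡ List.map suc (allReleased (κ ∘ suc)) ++
                  slot (releases (κ zero) (excess (tabulate (κ ∘ suc)))) zero
allReleased-suc {n} κ = begin
  released κ 0 (descending (suc n))
    ≡⟨ cong (released κ 0) (descending-suc n) ⟩
  released κ 0 (List.map suc (descending n) ++ zero ∷ [])
    ≡⟨ released-++ κ 0 (List.map suc (descending n)) _ ⟩
  released κ 0 (List.map suc (descending n)) ++
  slot (releases (κ zero) (waitAll κ 0 (List.map suc (descending n)))) zero ++ []
    ≡⟨ cong₂ _++_ (released-map κ 0 (descending n)) (trans (List.++-identityʳ _)
         (cong (λ h → slot (releases (κ zero) h) zero)
           (trans (waitAll-map κ 0 (descending n)) (sym (excess-tabulate (κ ∘ suc)))))) ⟩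
  List.map suc (allReleased (κ ∘ suc)) ++
  slot (releases (κ zero) (excess (tabulate (κ ∘ suc)))) zero ∎
  where open ≡-Reasoning

∈-released⇒N : ∀ {n} (κ : Fin n → Kind) h ks {k} → k ∈ released κ h ks → κ k ≡ N
∈-released⇒N κ h (j ∷ ks) k∈ with κ j in eq | h
... | U | h = ∈-released⇒N κ h ks k∈
... | D | h = ∈-released⇒N κ h ks k∈
... | B | h = ∈-released⇒N κ (suc h) ks k∈
... | N | zero = ∈-released⇒N κ zero ks k∈
∈-released⇒N κ h (j ∷ ks) (here refl) | N | suc _ = eq
∈-released⇒N κ h (j ∷ ks) (there k∈) | N | suc h′ = ∈-released⇒N κ h′ ks k∈

∈-slot : ∀ {A : Set} {b} {x : A} → T b → x ∈ slot b x
∈-slot {b = true} _ = here refl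

∈-slot⁻ : ∀ {A : Set} b {x y : A} → y ∈ slot b x → T b × y ≡ x
∈-slot⁻ true (here refl) = _ , refl

releasesAt : ∀ {n} → Config n → Fin n → Bool
releasesAt (k ∷ v) zero    = releases k (excess v)
releasesAt (k ∷ v) (suc j) = releasesAt v j

∈-allReleased⁺ : ∀ {n} (κ : Fin n → Kind) k → T (releasesAt (tabulate κ) k) → k ∈ allReleased κ
∈-allReleased⁺ κ zero    r rewrite allReleased-suc κ = ∈-++⁺ʳ _ (∈-slot r)
∈-allReleased⁺ κ (suc k) r rewrite allReleased-suc κ =
  ∈-++⁺ˡ (∈-map⁺ suc (∈-allReleased⁺ (κ ∘ suc) k r))

∈-allReleased⁻ : ∀ {n} (κ : Fin n → Kind) k → k ∈ allReleased κ → T (releasesAt (tabulate κ) k)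
∈-allReleased⁻ κ zero k∈ rewrite allReleased-suc κ
  with ∈-++⁻ (List.map suc (allReleased (κ ∘ suc))) k∈
... | inj₁ 0∈ with _ , _ , () ← ∈-map⁻ suc 0∈
... | inj₂ 0∈ = proj₁ (∈-slot⁻ _ 0∈)
∈-allReleased⁻ κ (suc k) k∈ rewrite allReleased-suc κ
  with ∈-++⁻ (List.map suc (allReleased (κ ∘ suc))) k∈
... | inj₁ k∈ with _ , k∈ , refl ← ∈-map⁻ suc k∈ = ∈-allReleased⁻ (κ ∘ suc) k k∈
... | inj₂ k∈ with () ← proj₂ (∈-slot⁻ (releases (κ zero) _) k∈)

has-left-un : ∀ {n} (v : Config n) k →
              T (has (leftConfig v) (un k)) ⇔ (lookup v k ≡ U ⊎ T (releasesAt v k))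
has-left-un (N ∷ v) zero = mk⇔ inj₂ λ { (inj₁ ()) ; (inj₂ r) → r }
has-left-un (U ∷ v) zero = mk⇔ (λ _ → inj₁ refl) _
has-left-un (D ∷ v) zero = mk⇔ (λ ()) λ { (inj₁ ()) ; (inj₂ ()) }
has-left-un (B ∷ v) zero = mk⇔ (λ ()) λ { (inj₁ ()) ; (inj₂ ()) }
has-left-un (_ ∷ v) (suc k) = has-left-un v k

has-right-bar : ∀ {n} (v : Config n) k →
                T (has (rightConfig v) (bar k)) ⇔ (lookup v k ≡ D ⊎ T (releasesAt v k))
has-right-bar (N ∷ v) zero = mk⇔ inj₂ λ { (inj₁ ()) ; (inj₂ r) → r }
has-right-bar (U ∷ v) zero = mk⇔ (λ ()) λ { (inj₁ ()) ; (inj₂ ()) }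
has-right-bar (D ∷ v) zero = mk⇔ (λ _ → inj₁ refl) _
has-right-bar (B ∷ v) zero = mk⇔ (λ ()) λ { (inj₁ ()) ; (inj₂ ()) }
has-right-bar (_ ∷ v) (suc k) = has-right-bar v k

has-left-bar : ∀ {n} (v : Config n) k → has (leftConfig v) (bar k) ≡ has v (bar k)
has-left-bar (_ ∷ v) zero    = refl
has-left-bar (_ ∷ v) (suc k) = has-left-bar v k

has-right-un : ∀ {n} (v : Config n) k → has (rightConfig v) (un k) ≡ has v (un k)
has-right-un (_ ∷ v) zero    = refl
has-right-un (_ ∷ v) (suc k) = has-right-un v k

∈-replace⁺ : ∀ {n} {a b x : Letter n} {w} → (x ∈ w × x ≢ a) ⊎ (x ≡ b × a ∈ w) → x ∈ replace a b w
∈-replace⁺ {a = a} {b} {x} {w} (inj₁ (x∈ , x≢a)) =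
  subst (_∈ replace a b w) kept (∈-map⁺ (λ c → if does (c ≟ a) then b else c) x∈)
  where
  kept : (if does (x ≟ a) then b else x) ≡ x
  kept rewrite dec-false (x ≟ a) x≢a = refl
∈-replace⁺ {a = a} {b} {w = w} (inj₂ (refl , a∈)) =
  subst (_∈ replace a b w) replaced (∈-map⁺ (λ c → if does (c ≟ a) then b else c) a∈)
  where
  replaced : (if does (a ≟ a) then b else a) ≡ b
  replaced rewrite dec-true (a ≟ a) refl = refl

∈-replace⁻ : ∀ {n} {a b x : Letter n} {w} → x ∈ replace a b w → (x ∈ w × x ≢ a) ⊎ (x ≡ b × a ∈ w)
∈-replace⁻ {a = a} {b} x∈ with ∈-map⁻ _ x∈
... | c , c∈ , eq with c ≟ a
...   | yes refl = inj₂ (eq , c∈)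
...   | no c≢a with refl ← eq = inj₁ (c∈ , c≢a)

module _ {n : ℕ} (ι : Fin n → Letter n)
         (ι-injective : ∀ {j k} → ι j ≡ ι k → j ≡ k) (C : Word n) where

  substituted : List (Fin n × Fin n) → Word n
  substituted = foldr (λ (z , t) → replace (ι z) (ι t)) C

  -- The replacements do not interfere: the z's are distinct and lie in C while the t's do not, so
  -- each z is still there when its turn comes and no t already placed is replaced again.
  ∈-substituted : ∀ s → AllPairs _≢_ (List.map proj₁ s) →
    All (λ z → ι z ∈ C) (List.map proj₁ s) → All (λ t → ι t ∉ C) (List.map proj₂ s) → ∀ x →
    x ∈ substituted s ⇔ ((x ∈ C × ∀ {z} → x ≡ ι z → z ∉ List.map proj₁ s) ⊎
                         (∃[ t ] x ≡ ι t × t ∈ List.map proj₂ s))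
  ∈-substituted [] _ _ _ x = mk⇔ (λ x∈ → inj₁ (x∈ , λ {_} _ ())) λ { (inj₁ (x∈ , _)) → x∈ ; (inj₂ (_ , _ , ())) }
  ∈-substituted ((z , t) ∷ s) (z≢ ∷ zs) (z∈ ∷ zs∈) (t∉ ∷ ts∉) x = mk⇔ to from
    where
    module IH x = Equivalence (∈-substituted s zs zs∈ ts∉ x)
    to : x ∈ replace (ι z) (ι t) (substituted s) → _
    to x∈ with ∈-replace⁻ x∈
    ... | inj₂ (refl , _) = inj₂ (t , refl , here refl)
    ... | inj₁ (x∈′ , x≢z) with IH.to x x∈′
    ...   | inj₁ (x∈C , x∉) = inj₁ (x∈C , λ { refl (here refl) → x≢z refl ; eq (there z∈) → x∉ eq z∈ })
    ...   | inj₂ (t′ , eq , t′∈) = inj₂ (t′ , eq , there t′∈)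
    from : _ → x ∈ replace (ι z) (ι t) (substituted s)
    from (inj₁ (x∈C , x∉)) = ∈-replace⁺ (inj₁
      (IH.from x (inj₁ (x∈C , λ eq z∈ → x∉ eq (there z∈))) , λ eq → x∉ eq (here refl)))
    from (inj₂ (_ , refl , here refl)) = ∈-replace⁺ (inj₂
      (refl , IH.from (ι z) (inj₁ (z∈ , λ eq z∈′ → All.lookup z≢ z∈′ (ι-injective eq)))))
    from (inj₂ (t′ , refl , there t′∈)) = ∈-replace⁺ (inj₁
      (IH.from x (inj₂ (t′ , refl , t′∈)) , λ eq → All.lookup ts∉ t′∈ (subst (_∈ C) (sym eq) z∈)))

T-does : ∀ {P : Set} (P? : Dec P) → T (does P?) ⇔ P
T-does (yes p) = mk⇔ (λ _ → p) _
T-does (no ¬p) = mk⇔ (λ ()) ¬p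

module _ {n : ℕ} {C : Word n} {s : List (Fin n × Fin n)} (eq : split C ≡ just s) where

  private
    v = contents C

  split-excess : excess v ≡ 0
  split-excess with split-outcome C
  ... | success _ _ h≡0 _ = trans (excess-tabulate (kind C)) h≡0
  ... | failure eq′ _ with () ← trans (sym eq) eq′

  private
    zs : List.map proj₁ s ≡ pairs C
    zs = choose-proj₁ C n (pairs C) eq

    ts : List.map proj₂ s ≡ allReleased (kind C)
    ts with split-outcome C
    ... | success _ eq′ _ ts≡ with refl ← trans (sym eq) eq′ = ts≡
    ... | failure eq′ _ with () ← trans (sym eq) eq′

    zs-unique : AllPairs _≢_ (List.map proj₁ s)
    zs-unique rewrite zs = AllPairs.filter⁺ (pair? C) 
      (AllPairs.map (λ j>k → Fin.<⇒≢ j>k ∘ sym) (descending-sorted n))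

    ∈-zs⁻ : ∀ {z} → z ∈ List.map proj₁ s → un z ∈ C × bar z ∈ C
    ∈-zs⁻ z∈ rewrite zs = proj₂ (∈-filter⁻ (pair? C) {xs = descending n} z∈)

    ∈-zs⁺ : ∀ {z} → un z ∈ C → bar z ∈ C → z ∈ List.map proj₁ s
    ∈-zs⁺ u∈ b∈ rewrite zs = ∈-filter⁺ (pair? C) (∈-descending _) (u∈ , b∈)

    ∈-ts⁻ : ∀ {t} → t ∈ List.map proj₂ s → un t ∉ C × bar t ∉ C
    ∈-ts⁻ {t} t∈ rewrite ts with kind C t | view C t | ∈-released⇒N (kind C) 0 (descending n) t∈
    ... | .N | neither u∉ b∉ | refl = u∉ , b∉

    ∈-ts : ∀ t → t ∈ List.map proj₂ s ⇔ T (releasesAt v t)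
    ∈-ts t rewrite ts = mk⇔ (∈-allReleased⁻ (kind C) t) (∈-allReleased⁺ (kind C) t)

    lookup-U : ∀ k → lookup v k ≡ U ⇔ (un k ∈ C × bar k ∉ C)
    lookup-U k rewrite Vec.lookup∘tabulate (kind C) k with kind C k | view C k
    ... | .U | onlyUn u∈ b∉ = mk⇔ (λ _ → u∈ , b∉) λ _ → refl
    ... | .N | neither u∉ _ = mk⇔ (λ ()) λ (u∈ , _) → ⊥-elim (u∉ u∈)
    ... | .D | onlyBar u∉ _ = mk⇔ (λ ()) λ (u∈ , _) → ⊥-elim (u∉ u∈)
    ... | .B | both _ b∈ = mk⇔ (λ ()) λ (_ , b∉) → ⊥-elim (b∉ b∈)

    lookup-D : ∀ k → lookup v k ≡ D ⇔ (un k ∉ C × bar k ∈ C)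
    lookup-D k rewrite Vec.lookup∘tabulate (kind C) k with kind C k | view C k
    ... | .D | onlyBar u∉ b∈ = mk⇔ (λ _ → u∉ , b∈) λ _ → refl
    ... | .N | neither _ b∉ = mk⇔ (λ ()) λ (_ , b∈) → ⊥-elim (b∉ b∈)
    ... | .U | onlyUn _ b∉ = mk⇔ (λ ()) λ (_ , b∈) → ⊥-elim (b∉ b∈)
    ... | .B | both u∈ _ = mk⇔ (λ ()) λ (u∉ , _) → ⊥-elim (u∉ u∈)

    ∈-contents : ∀ x → x ∈ C ⇔ T (has v x)
    ∈-contents (un k) rewrite Vec.lookup∘tabulate (kind C) k = ⇔-sym (T-does (un k ∈? C))
    ∈-contents (bar k) rewrite Vec.lookup∘tabulate (kind C) k = ⇔-sym (T-does (bar k ∈? C))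

  left-contents : contents (substituted un Sum.inj₁-injective C s) ≡ leftConfig v
  left-contents = contents-unique (leftConfig v) λ where
      (bar k) → mk⇔
        (λ x∈ → subst T (sym (has-left-bar v k)) (case Equivalence.to (iff (bar k)) x∈ of λ where
          (inj₁ (x∈C , _)) → Equivalence.to (∈-contents (bar k)) x∈C
          (inj₂ (_ , () , _))))
        (λ t → Equivalence.from (iff (bar k)) (inj₁
          (Equivalence.from (∈-contents (bar k)) (subst T (has-left-bar v k) t) , λ ())))
      (un k) → mk⇔
        (λ x∈ → Equivalence.from (has-left-un v k) (case Equivalence.to (iff (un k)) x∈ of λ where
          (inj₁ (x∈C , x∉)) → inj₁ (Equivalence.from (lookup-U k) (x∈C , λ b∈ → x∉ refl (∈-zs⁺ x∈C b∈)))
          (inj₂ (_ , refl , t∈)) → inj₂ (Equivalence.to (∈-ts k) t∈)))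
        (λ t → Equivalence.from (iff (un k)) (case Equivalence.to (has-left-un v k) t of λ where
          (inj₁ eq) → let u∈ , b∉ = Equivalence.to (lookup-U k) eq in
                      inj₁ (u∈ , λ { refl z∈ → b∉ (proj₂ (∈-zs⁻ z∈)) })
          (inj₂ r) → inj₂ (k , refl , Equivalence.from (∈-ts k) r)))
    where
    iff = ∈-substituted un Sum.inj₁-injective C s zs-unique
            (All.tabulate (proj₁ ∘ ∈-zs⁻)) (All.tabulate (proj₁ ∘ ∈-ts⁻))

  right-contents : contents (substituted bar Sum.inj₂-injective C s) ≡ rightConfig v
  right-contents = contents-unique (rightConfig v) λ where
      (un k) → mk⇔
        (λ x∈ → subst T (sym (has-right-un v k)) (case Equivalence.to (iff (un k)) x∈ of λ where
          (inj₁ (x∈C , _)) → Equivalence.to (∈-contents (un k)) x∈C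
          (inj₂ (_ , () , _))))
        (λ t → Equivalence.from (iff (un k)) (inj₁
          (Equivalence.from (∈-contents (un k)) (subst T (has-right-un v k) t) , λ ())))
      (bar k) → mk⇔
        (λ x∈ → Equivalence.from (has-right-bar v k) (case Equivalence.to (iff (bar k)) x∈ of λ where
          (inj₁ (x∈C , x∉)) → inj₁ (Equivalence.from (lookup-D k) ((λ u∈ → x∉ refl (∈-zs⁺ u∈ x∈C)) , x∈C))
          (inj₂ (_ , refl , t∈)) → inj₂ (Equivalence.to (∈-ts k) t∈)))
        (λ t → Equivalence.from (iff (bar k)) (case Equivalence.to (has-right-bar v k) t of λ where
          (inj₁ eq) → let u∉ , b∈ = Equivalence.to (lookup-D k) eq in
                      inj₁ (b∈ , λ { refl z∈ → u∉ (proj₁ (∈-zs⁻ z∈)) })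
          (inj₂ r) → inj₂ (k , refl , Equivalence.from (∈-ts k) r)))
    where
    iff = ∈-substituted bar Sum.inj₂-injective C s zs-unique
            (All.tabulate (proj₂ ∘ ∈-zs⁻)) (All.tabulate (proj₂ ∘ ∈-ts⁻))

excess-split : ∀ {n} (C : Word n) → excess (contents C) ≡ 0 → ∃[ s ] split C ≡ just s
excess-split C h≡0 with split-outcome C
... | success s eq _ _ = s , eq
... | failure _ h≢0 = ⊥-elim (h≢0 (trans (sym (excess-tabulate (kind C))) h≡0))

leftColumn-word : ∀ {n} (C : Column n) → leftColumn C ≡ word (leftConfig (contents (letters C)))
leftColumn-word C = trans (arrange-word (substituted un Sum.inj₁-injective (letters C) (splitting C)))
  (cong word (left-contents (Column.admissible C)))

rightColumn-word : ∀ {n} (C : Column n) → rightColumn C ≡ word (rightConfig (contents (letters C)))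
rightColumn-word C = trans (arrange-word (substituted bar Sum.inj₂-injective (letters C) (splitting C)))
  (cong word (right-contents (Column.admissible C)))

-- Comparison of columns

≤ˡ-refl : ∀ {n} {x : Letter n} → x ≤ˡ x
≤ˡ-refl {x = un k}  = ₁∼₁ ℕ.≤-refl
≤ˡ-refl {x = bar k} = ₂∼₂ ℕ.≤-refl

<ˡ⇒≤ˡ : ∀ {n} {x y : Letter n} → x <ˡ y → x ≤ˡ y
<ˡ⇒≤ˡ ₁∼₂     = ₁∼₂
<ˡ⇒≤ˡ (₁∼₁ p) = ₁∼₁ (ℕ.<⇒≤ p)
<ˡ⇒≤ˡ (₂∼₂ p) = ₂∼₂ (ℕ.<⇒≤ p)

<ˡ⇒≱ˡ : ∀ {n} {x y : Letter n} → x <ˡ y → ¬ y ≤ˡ x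
<ˡ⇒≱ˡ (₁∼₁ p) (₁∼₁ q) = ℕ.<⇒≱ p q
<ˡ⇒≱ˡ (₂∼₂ p) (₂∼₂ q) = ℕ.<⇒≱ p q

module _ {n : ℕ} where

  module _ (l r : Letter n → Bool) where

    ballotList : Word n → ℕ → Maybe ℕ
    ballotList []       g = just g
    ballotList (x ∷ xs) g = tick (l x) (r x) g >>= ballotList xs

    ballotList-++ : ∀ xs ys g → ballotList (xs ++ ys) g ≡ (ballotList xs g >>= ballotList ys)
    ballotList-++ []       ys g = refl
    ballotList-++ (x ∷ xs) ys g with tick (l x) (r x) g
    ... | nothing = refl
    ... | just g′ = ballotList-++ xs ys g′

    -- q lists the letters chosen by r that exceed the number of those chosen by l.
    Prefix-ballot : ∀ xs q → AllPairs _<ˡ_ xs → All (λ y → All (y <ˡ_) xs) q →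
      Prefix (flip _≤ˡ_) (filter (T? ∘ l) xs) (q ++ filter (T? ∘ r) xs) ⇔
      (∃[ g ] ballotList xs (length q) ≡ just g)
    Prefix-ballot [] q _ _ = mk⇔ (λ _ → length q , refl) λ _ → []
    Prefix-ballot (x ∷ xs) q (x< ∷ sorted) <xs
      rewrite filter-slot (T? ∘ l) x xs | filter-slot (T? ∘ r) x xs
      = go (l x) (r x) q <xs
      where
      go : ∀ a b q → All (λ y → All (y <ˡ_) (x ∷ xs)) q →
           Prefix (flip _≤ˡ_) (slot a x ++ filter (T? ∘ l) xs)
                              (q ++ slot b x ++ filter (T? ∘ r) xs) ⇔
           (∃[ g ] (tick a b (length q) >>= ballotList xs) ≡ just g)
      enqueue : ∀ q → All (λ y → All (y <ˡ_) (x ∷ xs)) q →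
           Prefix (flip _≤ˡ_) (filter (T? ∘ l) xs) (q ++ x ∷ filter (T? ∘ r) xs) ⇔
           (∃[ g ] ballotList xs (suc (length q)) ≡ just g)
      enqueue q <xs rewrite sym (List.++-assoc q (x ∷ []) (filter (T? ∘ r) xs))
        | sym (trans (List.length-++ q {x ∷ []}) (ℕ.+-comm (length q) 1)) =
        Prefix-ballot xs (q ++ x ∷ []) sorted (All.++⁺ (All.map All.tail <xs) (x< ∷ []))
      cons : ∀ {y as bs} → y ≤ˡ x → Prefix (flip _≤ˡ_) as bs ⇔ Prefix (flip _≤ˡ_) (x ∷ as) (y ∷ bs)
      cons y≤x = mk⇔ (y≤x ∷_) λ { (_ ∷ ps) → ps }
      go false false q <xs = Prefix-ballot xs q sorted (All.map All.tail <xs)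
      go false true  q <xs = enqueue q <xs
      go true true [] _ = Prefix-ballot xs [] sorted [] ⇔-∘ ⇔-sym (cons ≤ˡ-refl)
      -- The letter x of l is compared with the oldest unmatched letter y, and the letter x of r
      -- joins the end of the queue.
      go true true (y ∷ q) ((y<x ∷ _) ∷ <xs) = enqueue q <xs ⇔-∘ ⇔-sym (cons (<ˡ⇒≤ˡ y<x))
      go true false (y ∷ q) ((y<x ∷ _) ∷ <xs) =
        Prefix-ballot xs q sorted (All.map All.tail <xs) ⇔-∘ ⇔-sym (cons (<ˡ⇒≤ˡ y<x))
      -- Nothing is waiting, and every later letter of r exceeds x, so this row of the prefix fails.
      go true false [] _ = mk⇔ (λ pre → ⊥-elim (too-large _ (All.filter⁺ (T? ∘ r) x<) pre)) λ ()
        where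
        too-large : ∀ {as} bs → All (x <ˡ_) bs → ¬ Prefix (flip _≤ˡ_) (x ∷ as) bs
        too-large (b ∷ bs) (x<b ∷ _) (b≤x ∷ _) = <ˡ⇒≱ˡ x<b b≤x

ballotList-map : ∀ {n} (l r : Letter (suc n) → Bool) xs g →
                 ballotList l r (List.map ↑ xs) g ≡ ballotList (l ∘ ↑) (r ∘ ↑) xs g
ballotList-map l r [] g = refl
ballotList-map l r (x ∷ xs) g = >>=-cong {m = tick (l (↑ x)) (r (↑ x)) g} refl (ballotList-map l r xs)

ballotList-cong : ∀ {n} {l r l′ r′ : Letter n → Bool} → (∀ x → l x ≡ l′ x) → (∀ x → r x ≡ r′ x) →
                  ∀ xs g → ballotList l r xs g ≡ ballotList l′ r′ xs g
ballotList-cong p q [] g = refl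
ballotList-cong p q (x ∷ xs) g = >>=-cong (cong₂ (λ a b → tick a b g) (p x) (q x)) (ballotList-cong p q xs)

has-↑ : ∀ {n} k (v : Config n) x → has (k ∷ v) (↑ x) ≡ has v x
has-↑ k v (un _)  = refl
has-↑ k v (bar _) = refl

ballot-alphabet : ∀ {n} (v w : Config n) g →
                  ballot v w g ≡ ballotList (has v) (has w) (alphabet n) g
ballot-alphabet [] [] g = refl
ballot-alphabet {suc n} (k ∷ v) (m ∷ w) g = trans
  (>>=-cong {m = tick (proj₁ k) (proj₁ m) g} refl λ g → sym (trans
    (ballotList-++ l r (List.map ↑ (alphabet n)) (bar zero ∷ []) g)
    (>>=-cong (trans (ballotList-map l r (alphabet n) g)
        (trans (ballotList-cong (has-↑ k v) (has-↑ m w) (alphabet n) g)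
          (sym (ballot-alphabet v w g))))
      λ g → >>=-just (tick (proj₂ k) (proj₂ m) g))))
  (cong (λ xs → ballotList l r xs g) (sym (alphabet-suc n)))
  where
  l = has (k ∷ v)
  r = has (m ∷ w)
  >>=-just : ∀ (m : Maybe ℕ) → (m >>= just) ≡ m
  >>=-just nothing  = refl
  >>=-just (just _) = refl

Prefix-word : ∀ {n} (v w : Config n) →
  Prefix (flip _≤ˡ_) (word v) (word w) ⇔ (∃[ g ] ballot v w 0 ≡ just g)
Prefix-word v w rewrite word-filter v | word-filter w | ballot-alphabet v w 0 =
  Prefix-ballot (has v) (has w) (alphabet _) [] (alphabet-sorted _) []

-- The extra symbol `ϵ` as the empty column

contentsᴬ : ∀ {n} → ACol n → Config n
contentsᴬ a = contents (lettersᴬ a)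

word-contentsᴬ : ∀ {n} (a : ACol n) → word (contentsᴬ a) ≡ lettersᴬ a
word-contentsᴬ (col C) = word-contents (Column.increasing C)
word-contentsᴬ ϵ       = word-contents []

excess-[] : ∀ n → excess (contents {n} []) ≡ 0
excess-[] zero    = refl
excess-[] (suc n) = cong pred (excess-[] n)

leftConfig-[] : ∀ n → leftConfig (contents {n} []) ≡ contents []
leftConfig-[] zero    = refl
leftConfig-[] (suc n) = cong₂ _∷_ (cong (λ h → positive h , false) (excess-[] n)) (leftConfig-[] n)

rightConfig-[] : ∀ n → rightConfig (contents {n} []) ≡ contents []
rightConfig-[] zero    = refl
rightConfig-[] (suc n) = cong₂ _∷_ (cong (λ h → false , positive h) (excess-[] n)) (rightConfig-[] n)

excess-contentsᴬ : ∀ {n} (a : ACol n) → excess (contentsᴬ a) ≡ 0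
excess-contentsᴬ (col C) = split-excess (Column.admissible C)
excess-contentsᴬ {n} ϵ   = excess-[] n

fromConfig : ∀ {n} (v : Config n) → excess v ≡ 0 → ∃[ a ] lettersᴬ a ≡ word v
fromConfig v h≡0 with word v in eq
... | []    = ϵ , refl
... | x ∷ w = col record
  { first      = x
  ; rest       = w
  ; increasing = subst (Linked _<ˡ_) eq (word-increasing v)
  ; splitting  = proj₁ s
  ; admissible = proj₂ s
  } , refl
  where
  s = excess-split (x ∷ w)
        (trans (cong excess (trans (cong contents (sym eq)) (contents-word v))) h≡0)

-- Splitting on the left keeps every barred letter and every unbarred letter outside a pair. This
-- rules out ϵ ⪯ c for a genuine column c in the ballot criterion.
leftConfig-nonempty : ∀ {n} (v : Config n) {x} → x ∈ word v → ∃[ y ] y ∈ word (leftConfig v)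
leftConfig-nonempty v {bar k} x∈ = bar k , Equivalence.from (∈-word (leftConfig v))
  (subst T (sym (has-left-bar v k)) (Equivalence.to (∈-word v) x∈))
leftConfig-nonempty v {un k} x∈ with lookup v k in eq | Equivalence.to (∈-word v) x∈
... | true , false | _ = un k , Equivalence.from (∈-word (leftConfig v))
  (Equivalence.from (has-left-un v k) (inj₁ eq))
... | true , true | _ = bar k , Equivalence.from (∈-word (leftConfig v))
  (subst T (sym (trans (has-left-bar v k) (cong proj₂ eq))) _)

-- With ϵ read as the empty column, the conventions for ϵ become instances of the criterion: an
-- empty left half is below nothing, and an empty right half covers no nonempty one.
⪯-ballot : ∀ {n} (c d : ACol n) → c ⪯ᴬ d ⇔
  (∃[ g ] ballot (leftConfig (contentsᴬ d)) (rightConfig (contentsᴬ c)) 0 ≡ just g)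
⪯-ballot {n} c ϵ = mk⇔ (λ _ → Equivalence.to
    (Prefix-word (leftConfig (contentsᴬ ϵ)) (rightConfig (contentsᴬ c)))
    (subst (λ w → Prefix (flip _≤ˡ_) w (word (rightConfig (contentsᴬ c)))) (sym empty) []))
  λ _ → c ⪯ϵ
  where
  empty : word (leftConfig (contentsᴬ {n} ϵ)) ≡ []
  empty = trans (cong word (leftConfig-[] n)) (word-contentsᴬ ϵ)
⪯-ballot (col C) (col E) =
  Prefix-word (leftConfig (contents (letters E))) (rightConfig (contents (letters C))) ⇔-∘
  mk⇔ (λ { (col le) → subst₂ (Prefix (flip _≤ˡ_)) (leftColumn-word E) (rightColumn-word C) le })
      (λ le → col (subst₂ (Prefix (flip _≤ˡ_)) (sym (leftColumn-word E)) (sym (rightColumn-word C)) le))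
⪯-ballot {n} ϵ (col E) = mk⇔ (λ ()) λ b → ⊥-elim (absurd
  (proj₂ (leftConfig-nonempty (contents (letters E)) first∈))
  (subst (Prefix (flip _≤ˡ_) (word (leftConfig (contents (letters E))))) empty (Equivalence.from
    (Prefix-word (leftConfig (contents (letters E))) (rightConfig (contents []))) b)))
  where
  first∈ : Column.first E ∈ word (contents (letters E))
  first∈ = subst (Column.first E ∈_) (sym (word-contentsᴬ (col E))) (here refl)
  empty : word (rightConfig (contentsᴬ {n} ϵ)) ≡ []
  empty = trans (cong word (rightConfig-[] n)) (word-contentsᴬ ϵ)
  absurd : ∀ {y : Letter n} {w} → y ∈ w → ¬ Prefix (flip _≤ˡ_) w []
  absurd (here _) ()
  absurd (there _) ()

-- Edges and rewriting steps

~-refl : ∀ {n} {w : Word n} → w ~ w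
~-refl = record { iso = inverse _ ; edge = λ _ _ _ → mk⇔ id id ; place = refl }

data Direction : Set where
  forward backward : Direction

module _ {n : ℕ} (i : Fin n) where

  Fᵈ : Direction → Word n → Word n → Set
  Fᵈ forward  w w′ = F i w w′
  Fᵈ backward w w′ = F i w′ w

  Fᵈ-length : ∀ d {w w′} → Fᵈ d w w′ → length w ≡ length w′
  Fᵈ-length forward  r = F-length i r
  Fᵈ-length backward r = sym (F-length i r)

  ~-Fᵈ : ∀ d {w z w′} → w ~ z → Fᵈ d w w′ → ∃[ z′ ] Fᵈ d z z′ × w′ ~ z′
  ~-Fᵈ forward  = ~-F
  ~-Fᵈ backward = ~-F⁻

  -- The factor on which f acts does not change under plactic congruence.
  data Tensorᵈ (d : Direction) (u v u′ v′ : Word n) : Set where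
    left  : Fᵈ d u u′ → v ≡ v′ →
            (∀ {y y′ z} → u ~ y → u′ ~ y′ → v ~ z → Fᵈ d y y′ → Fᵈ d (y ++ z) (y′ ++ z)) →
            Tensorᵈ d u v u′ v′
    right : u ≡ u′ → Fᵈ d v v′ →
            (∀ {y z z′} → u ~ y → v ~ z → v′ ~ z′ → Fᵈ d z z′ → Fᵈ d (y ++ z) (y ++ z′)) →
            Tensorᵈ d u v u′ v′

  Fᵈ-tensor : ∀ d {u v u′ v′} → length u ≡ length u′ →
              Fᵈ d (u ++ v) (u′ ++ v′) → Tensorᵈ d u v u′ v′
  Fᵈ-tensor forward {u} {v} {u′} {v′} len r with F-Tensor i {u} {v} {u′} {v′} len r
  ... | left s eq lt = left s eq λ u~y _ v~z s → F-++ˡ i s (subst₂ _<_ (~-ε v~z) (~-φ u~y) lt)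
  ... | right eq s le = right eq s λ u~y v~z _ s →
    F-++ʳ i _ (subst₂ _≤_ (~-φ u~y) (~-ε v~z) le) s
  -- Read backwards, the inequality between ε and φ holds for the primed words, which are the source
  -- of the arrow.
  Fᵈ-tensor backward {u} {v} {u′} {v′} len r with F-Tensor i {u′} {v′} {u} {v} (sym len) r
  ... | left s refl lt = left s refl λ _ u′~y v~z s → F-++ˡ i s (subst₂ _<_ (~-ε v~z) (~-φ u′~y) lt)
  ... | right refl s le = right refl s λ u~y _ v′~z s →
    F-++ʳ i _ (subst₂ _≤_ (~-φ u~y) (~-ε v′~z) le) s

  SameLength : ACol n → ACol n → Set
  SameLength a b = length (lettersᴬ a) ≡ length (lettersᴬ b)

  -- A move keeps the final queue length, and its vanishing is admissibility.
  ACol-Fᵈ : ∀ d a {w} → Fᵈ d (lettersᴬ a) w → ∃[ a′ ] lettersᴬ a′ ≡ w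
  ACol-Fᵈ forward a r
    with F-word (contentsᴬ a) (subst (λ w → F i w _) (sym (word-contentsᴬ a)) r)
  ... | v′ , refl , m = fromConfig v′ (trans (sym (Move-excess m)) (excess-contentsᴬ a))
  ACol-Fᵈ backward a r
    with F-word⁻ (contentsᴬ a) (subst (F i _) (sym (word-contentsᴬ a)) r)
  ... | v′ , refl , m = fromConfig v′ (trans (Move-excess m) (excess-contentsᴬ a))

  ACol-Move : ∀ {a a′} → F i (lettersᴬ a) (lettersᴬ a′) → Move i (contentsᴬ a) (contentsᴬ a′)
  ACol-Move {a} {a′} r
    with F-word (contentsᴬ a) (subst (λ w → F i w _) (sym (word-contentsᴬ a)) r)
  ... | v′ , eq , m = subst (Move i (contentsᴬ a)) (sym (trans (cong contents eq) (contents-word v′))) m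

  -- A `Column` carries proofs besides its reading; the ballot criterion sees only the reading.
  ⪯-resp : ∀ {a b a′ b′ : ACol n} → lettersᴬ a ≡ lettersᴬ a′ → lettersᴬ b ≡ lettersᴬ b′ →
           b ⪯ᴬ a → b′ ⪯ᴬ a′
  ⪯-resp {a} {b} {a′} {b′} p q le = Equivalence.from (⪯-ballot b′ a′)
    (subst₂ (λ x y → ∃[ g ] ballot (leftConfig (contents x)) (rightConfig (contents y)) 0 ≡ _)
      p q (Equivalence.to (⪯-ballot b a) le))

  ⪯-F : ∀ {a b a′ b′ : ACol n} → SameLength a a′ →
        F i (lettersᴬ a ++ lettersᴬ b) (lettersᴬ a′ ++ lettersᴬ b′) → b ⪯ᴬ a ⇔ b′ ⪯ᴬ a′
  ⪯-F {a} {b} {a′} {b′} len r = mk⇔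
    (λ le → Equivalence.from (⪯-ballot b′ a′)
      (subst (λ m → ∃[ g ] m ≡ _) ballots (Equivalence.to (⪯-ballot b a) le)))
    (λ le → Equivalence.from (⪯-ballot b a)
      (subst (λ m → ∃[ g ] m ≡ _) (sym ballots) (Equivalence.to (⪯-ballot b′ a′) le)))
    where
    ballots : ballot (leftConfig (contentsᴬ a)) (rightConfig (contentsᴬ b)) 0 ≡
              ballot (leftConfig (contentsᴬ a′)) (rightConfig (contentsᴬ b′)) 0
    ballots with F-Tensor i {lettersᴬ a} {lettersᴬ b} {lettersᴬ a′} {lettersᴬ b′} len r
    ... | left s eq lt = trans
      (ballot-left (contentsᴬ b) (ACol-Move {a} {a′} s)
        (subst₂ (λ x y → εʷ i x < φʷ i y) (sym (word-contentsᴬ b)) (sym (word-contentsᴬ a)) lt) 0)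
      (cong (λ w → ballot (leftConfig (contentsᴬ a′)) (rightConfig (contents w)) 0) eq)
    ... | right eq s le = trans
      (ballot-right (contentsᴬ a) (ACol-Move {b} {b′} s)
        (subst₂ (λ x y → φʷ i x ≤ εʷ i y) (sym (word-contentsᴬ a)) (sym (word-contentsᴬ b)) le) 0)
      (cong (λ w → ballot (leftConfig (contents w)) (rightConfig (contentsᴬ b′)) 0) eq)

  ⪯-Fᵈ : ∀ d {a b a′ b′ : ACol n} → SameLength a a′ →
         Fᵈ d (lettersᴬ a ++ lettersᴬ b) (lettersᴬ a′ ++ lettersᴬ b′) → b ⪯ᴬ a ⇔ b′ ⪯ᴬ a′
  ⪯-Fᵈ forward  len r = ⪯-F len r
  ⪯-Fᵈ backward len r = let eq = ⪯-F (sym len) r in mk⇔ (Equivalence.from eq) (Equivalence.to eq)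

  ++-split-length : ∀ (u : Word n) {v w : Word n} → length (u ++ v) ≡ length w →
                    ∃[ u′ ] ∃[ v′ ] w ≡ u′ ++ v′ × length u ≡ length u′
  ++-split-length []      {w = w}     _   = [] , w , refl , refl
  ++-split-length (_ ∷ u) {v} {x ∷ w} len with ++-split-length u {v} {w} (ℕ.suc-injective len)
  ... | u′ , v′ , refl , eq = x ∷ u′ , v′ , refl , cong suc eq

  pair-Fᵈ : ∀ d a b {w} → Fᵈ d (lettersᴬ a ++ lettersᴬ b) w →
            ∃[ a′ ] ∃[ b′ ] w ≡ lettersᴬ a′ ++ lettersᴬ b′ × SameLength a a′ × SameLength b b′
  pair-Fᵈ d a b {w} r with ++-split-length (lettersᴬ a) {lettersᴬ b} {w} (Fᵈ-length d r)
  ... | u′ , v′ , refl , len with Fᵈ-tensor d {lettersᴬ a} {lettersᴬ b} {u′} {v′} len r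
  ...   | left s refl _ with ACol-Fᵈ d a s
  ...     | a′ , refl = a′ , b , refl , len , refl
  pair-Fᵈ d a b r | _ , _ , refl , len | right refl s _ with ACol-Fᵈ d b s
  ...     | b′ , refl = a , b′ , refl , refl , Fᵈ-length d s

  p₂ : ACol n → ACol n → Word n
  p₂ a b = lettersᴬ a ++ lettersᴬ b

  p-two : ∀ a b → p (a ∷ b ∷ []) ≡ p₂ a b
  p-two a b = cong (lettersᴬ a ++_) (List.++-identityʳ (lettersᴬ b))

  -- The three shapes of a result are the three ways in which d₂ ⪯ᴬ d₁ can hold: two columns, ϵ
  -- followed by a column, or twice ϵ. One condition thus replaces a case distinction on `two`,
  -- `one` and `none`.
  record Rule (a b d₁ d₂ : ACol n) : Set where
    constructor rule
    field
      reducible : ¬ (b ⪯ᴬ a)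
      reduced   : d₂ ⪯ᴬ d₁
      plactic   : p₂ a b ~ p₂ d₁ d₂

  ⇒-Rule : ∀ {a b d₁ d₂} → a · b ⇒ d₁ · d₂ → Rule a b d₁ d₂
  ⇒-Rule {a} {b} (nle , two {D₁} {D₂} record { tableau = le ∷ _ ; plactic = eq }) =
    rule nle (col le) (subst₂ _~_ (p-two a b) (p-two (col D₁) (col D₂)) eq)
  ⇒-Rule {a} {b} (nle , one {E} record { plactic = eq }) =
    rule nle (col E ⪯ϵ) (subst₂ _~_ (p-two a b) (List.++-identityʳ (letters E)) eq)
  ⇒-Rule {a} {b} (nle , none record { plactic = eq }) =
    rule nle (ϵ ⪯ϵ) (subst (_~ []) (p-two a b) eq)

  Rule-⇒ : ∀ {a b d₁ d₂} → Rule a b d₁ d₂ → a · b ⇒ d₁ · d₂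
  Rule-⇒ {a} {b} (rule nle (col {D₂} {D₁} le) eq) = nle , two record
    { tableau = le ∷ [-]
    ; plactic = subst₂ _~_ (sym (p-two a b)) (sym (p-two (col D₁) (col D₂))) eq }
  Rule-⇒ {a} {b} (rule nle (col E ⪯ϵ) eq) = nle , one record
    { tableau = [-]
    ; plactic = subst₂ _~_ (sym (p-two a b)) (sym (List.++-identityʳ (letters E))) eq }
  Rule-⇒ {a} {b} (rule nle (ϵ ⪯ϵ) eq) = nle , none record
    { tableau = [] ; plactic = subst (_~ []) (sym (p-two a b)) eq }

  Rule-resp : ∀ {a b a′ b′ d₁ d₂} → lettersᴬ a ≡ lettersᴬ a′ → lettersᴬ b ≡ lettersᴬ b′ →
              Rule a b d₁ d₂ → Rule a′ b′ d₁ d₂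
  Rule-resp {a} {b} {a′} {b′} p q (rule nle le eq) = rule
    (nle ∘ ⪯-resp {a′} {b′} {a} {b} (sym p) (sym q)) le (subst (_~ _) (cong₂ _++_ p q) eq)

  -- The congruence copies the arrow onto d₁d₂, whose image is cut at the old length of d₁.
  -- Invariance of ⪯ is used twice: the new source stays reducible and the new target stays a
  -- tableau.
  Rule-Fᵈ : ∀ d {a b a′ b′ d₁ d₂} → SameLength a a′ → Fᵈ d (p₂ a b) (p₂ a′ b′) → Rule a b d₁ d₂ →
            ∃[ d₁′ ] ∃[ d₂′ ] Rule a′ b′ d₁′ d₂′ × Fᵈ d (p₂ d₁ d₂) (p₂ d₁′ d₂′) ×
                              SameLength d₁ d₁′ × SameLength d₂ d₂′
  Rule-Fᵈ d {a} {b} {a′} {b′} {d₁} {d₂} len r (rule nle le eq) with ~-Fᵈ d eq r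
  ... | _ , s , eq′ with pair-Fᵈ d d₁ d₂ s
  ...   | d₁′ , d₂′ , refl , len₁ , len₂ =
    d₁′ , d₂′ , rule (nle ∘ Equivalence.from (⪯-Fᵈ d {a} {b} {a′} {b′} len r))
                     (Equivalence.to (⪯-Fᵈ d {d₁} {d₂} {d₁′} {d₂′} len₁ s) le) eq′ , s , len₁ , len₂

  -- Unlike `Edge`, this does not name the column that changes. After a rewriting step the changed
  -- letter may sit in another column, but the arrow between the readings and the matching cuts
  -- survive.
  record Adjacent (d : Direction) (w w′ : List (ACol n)) : Set where
    constructor adjacent
    field
      move    : Fᵈ d (p w) (p w′)
      lengths : Pointwise SameLength w w′

  p-12 : ∀ a b c → p (a ∷ b ∷ c ∷ []) ≡ p₂ a b ++ lettersᴬ c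
  p-12 a b c = trans (cong (λ w → lettersᴬ a ++ lettersᴬ b ++ w) (List.++-identityʳ (lettersᴬ c)))
                     (sym (List.++-assoc (lettersᴬ a) (lettersᴬ b) (lettersᴬ c)))

  p-23 : ∀ a b c → p (a ∷ b ∷ c ∷ []) ≡ lettersᴬ a ++ p₂ b c
  p-23 a b c = cong (lettersᴬ a ++_) (p-two b c)

  length-p₂ : ∀ {a b a′ b′} → SameLength a a′ → SameLength b b′ →
              length (p₂ a b) ≡ length (p₂ a′ b′)
  length-p₂ {a} {b} {a′} {b′} p q = trans (List.length-++ (lettersᴬ a))
    (trans (cong₂ _+_ p q) (sym (List.length-++ (lettersᴬ a′))))

  Step-adjacent : ∀ d {s w w′ x} → Adjacent d w w′ → Step s w x →
                  ∃[ x′ ] Adjacent d x x′ × Step s w′ x′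
  Step-adjacent d {w = a ∷ b ∷ c ∷ []} {a′ ∷ b′ ∷ c′ ∷ []}
    (adjacent r (la ∷ lb ∷ lc ∷ [])) (step₁₂ {a′ = d₁} {d₂} st)
    with Fᵈ-tensor d {p₂ a b} {lettersᴬ c} {p₂ a′ b′} {lettersᴬ c′}
           (length-p₂ {a} {b} {a′} {b′} la lb) (subst₂ (Fᵈ d) (p-12 a b c) (p-12 a′ b′ c′) r)
  ... | left s c≡ transport with Rule-Fᵈ d {a} {b} {a′} {b′} la s (⇒-Rule st)
  ...   | d₁′ , d₂′ , ru , s′ , l₁ , l₂ = d₁′ ∷ d₂′ ∷ c′ ∷ [] ,
    adjacent (subst₂ (Fᵈ d) (sym (p-12 d₁ d₂ c))
        (trans (cong (p₂ d₁′ d₂′ ++_) c≡) (sym (p-12 d₁′ d₂′ c′)))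
        (transport (Rule.plactic (⇒-Rule st)) (Rule.plactic ru) ~-refl s′))
      (l₁ ∷ l₂ ∷ lc ∷ []) ,
    step₁₂ (Rule-⇒ ru)
  -- The operator acts outside the rewritten pair: the pair keeps its letters and its result, and by
  -- plactic invariance the operator still acts on the third column.
  Step-adjacent d {w = a ∷ b ∷ c ∷ []} {a′ ∷ b′ ∷ c′ ∷ []}
    (adjacent r (la ∷ lb ∷ lc ∷ [])) (step₁₂ {a′ = d₁} {d₂} st) | right ab≡ s transport
    with ++-split i (lettersᴬ a) (lettersᴬ a′) la ab≡
  ... | a≡ , b≡ = d₁ ∷ d₂ ∷ c′ ∷ [] ,
    adjacent (subst₂ (Fᵈ d) (sym (p-12 d₁ d₂ c)) (sym (p-12 d₁ d₂ c′))
        (transport (Rule.plactic (⇒-Rule st)) ~-refl ~-refl s))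
      (refl ∷ refl ∷ lc ∷ []) ,
    step₁₂ (Rule-⇒ (Rule-resp {a} {b} {a′} {b′} a≡ b≡ (⇒-Rule st)))
  Step-adjacent d {w = a ∷ b ∷ c ∷ []} {a′ ∷ b′ ∷ c′ ∷ []}
    (adjacent r (la ∷ lb ∷ lc ∷ [])) (step₂₃ {b′ = d₁} {d₂} st)
    with Fᵈ-tensor d {lettersᴬ a} {p₂ b c} {lettersᴬ a′} {p₂ b′ c′} la
           (subst₂ (Fᵈ d) (p-23 a b c) (p-23 a′ b′ c′) r)
  ... | right a≡ s transport with Rule-Fᵈ d {b} {c} {b′} {c′} lb s (⇒-Rule st)
  ...   | d₁′ , d₂′ , ru , s′ , l₁ , l₂ = a′ ∷ d₁′ ∷ d₂′ ∷ [] ,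
    adjacent (subst₂ (Fᵈ d) (sym (p-23 a d₁ d₂))
        (trans (cong (_++ p₂ d₁′ d₂′) a≡) (sym (p-23 a′ d₁′ d₂′)))
        (transport ~-refl (Rule.plactic (⇒-Rule st)) (Rule.plactic ru) s′))
      (la ∷ l₁ ∷ l₂ ∷ []) ,
    step₂₃ (Rule-⇒ ru)
  Step-adjacent d {w = a ∷ b ∷ c ∷ []} {a′ ∷ b′ ∷ c′ ∷ []}
    (adjacent r (la ∷ lb ∷ lc ∷ [])) (step₂₃ {b′ = d₁} {d₂} st) | left s bc≡ transport
    with ++-split i (lettersᴬ b) (lettersᴬ b′) lb bc≡
  ... | b≡ , c≡ = a′ ∷ d₁ ∷ d₂ ∷ [] ,
    adjacent (subst₂ (Fᵈ d) (sym (p-23 a d₁ d₂)) (sym (p-23 a′ d₁ d₂))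
        (transport ~-refl ~-refl (Rule.plactic (⇒-Rule st)) s))
      (la ∷ refl ∷ refl ∷ []) ,
    step₂₃ (Rule-⇒ (Rule-resp {b} {c} {b′} {c′} b≡ c≡ (⇒-Rule st)))

  Alternating-adjacent : ∀ d {s w w′ k} → Adjacent d w w′ → Alternating s w k → Alternating s w′ k
  Alternating-adjacent d adj done = done
  Alternating-adjacent d adj (st then alt) with Step-adjacent d adj st
  ... | _ , adj′ , st′ = st′ then Alternating-adjacent d adj′ alt

  Edge-Adjacent : ∀ {w w′} → Edge i w w′ → Adjacent forward w w′
  Edge-Adjacent (edge xs {C} {C′} ys eq) =
    adjacent r (Pointwise.++⁺ (Pointwise.refl refl) (lengths ∷ Pointwise.refl refl))
    where
    r : F i (p (xs ++ col C ∷ ys)) (p (xs ++ col C′ ∷ ys))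
    r = F-complete i _ (trans eq (cong just (sym (List.concatMap-++ lettersᴬ xs (col C′ ∷ ys)))))
    lengths : length (letters C) ≡ length (letters C′)
    -- The arrow preserves the total length; cancelling the columns on both sides leaves the one
    -- that changes.
    lengths = ℕ.+-cancelʳ-≡ (length (p ys)) _ _ (ℕ.+-cancelˡ-≡ (length (p xs)) _ _
      (trans (sym (total C)) (trans (F-length i r) (total C′))))
      where
      total : ∀ C → length (p (xs ++ col C ∷ ys)) ≡ length (p xs) + (length (letters C) + length (p ys))
      total C = trans (cong length (List.concatMap-++ lettersᴬ xs (col C ∷ ys)))
        (trans (List.length-++ (p xs)) (cong (length (p xs) +_) (List.length-++ (letters C))))

  Adjacent-flip : ∀ {w w′} → Adjacent forward w w′ → Adjacent backward w′ w
  Adjacent-flip (adjacent r ls) = adjacent r (Pointwise.symmetric sym ls)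

Alternating-connected : ∀ {n s k} {w w′ : List (ACol n)} → Connected w w′ →
                        Alternating s w k → Alternating s w′ k
Alternating-connected ε = id
Alternating-connected (fwd (i , r) ◅ c) =
  Alternating-connected c ∘ Alternating-adjacent i forward (Edge-Adjacent i r)
Alternating-connected (bwd (i , r) ◅ c) =
  Alternating-connected c ∘ Alternating-adjacent i backward (Adjacent-flip i (Edge-Adjacent i r))

-- The sequence itself travels along the path, while maximality pulls a rival sequence back along
-- the reversed path.
Longest-connected : ∀ {n s k} {w w′ : List (ACol n)} → Connected w w′ → Longest s w k → Longest s w′ k
Longest-connected c l = record
  { attained = Alternating-connected c attained
  ; maximal  = λ m → maximal m ∘ Alternating-connected (symmetric _ c)
  }
  where open Longest l

theorem3p11 : ∀ (n : ℕ) (t u v : ACol n) (w⁰ : List (ACol n)) →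
    Connected (t ∷ u ∷ v ∷ []) w⁰ → HighestWeight w⁰ →
    ∀ (kl : ℕ × ℕ) → Conf (t ∷ u ∷ v ∷ []) kl ⇔ Conf w⁰ kl
theorem3p11 n t u v w⁰ c _ (k , l) = mk⇔
  (λ (a , b) → Longest-connected c a , Longest-connected c b)
  (λ (a , b) → Longest-connected (symmetric _ c) a , Longest-connected (symmetric _ c) b)
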